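{- Let $n\ge 1$ and let $x_1,\dots,x_n,\lambda$ be indeterminates. Then \[\prod_{1\le i<j\le n}(x_i+\lambda x_j)=\sum_{\alpha\in Y_n(\{b,r,g,y\})}\lambda^{E(\alpha)}\prod_{i=1}^{n-1}x_i^{\,n-i-E_i(\alpha)}\sum_{\alpha'}\ \prod_{d=2}^{n}x_d^{E^d(\alpha')},\] where the inner sum is over all row shuffles $\alpha'$ of $\alpha$. Moreover, \[(1+\lambda)^{\binom n2}=\sum_{\alpha\in Y_n(\{b,r,g,y\})}\lambda^{E(\alpha)}\prod_{1\le i\le k\le n-1}\binom{C_{i+1,k}(\alpha)}{E_{i,k}(\alpha)}.\]
   Context: For a set $S\subseteq\{r,b,y\}$, let $Y_n(S\cup\{g\})$ be the set of integer arrays $\alpha=(\alpha_{i,j})$, $1\le i\le n$, $0\le j\le n-i$, with $i\le\alpha_{i,j}\le i+j$ and satisfying, whenever the entries involved are defined: if $r\in S$, $\alpha_{i,j}\le\alpha_{i-1,j+1}+1$; if $b\in S$, $\alpha_{i,j}\le\alpha_{i+1,j-1}$; if $y\in S$, $\alpha_{i,j}\le\alpha_{i,j+1}$. So $Y_n(\{b,r,g,y\})$ uses all three conditions and $Y_n(\{b,r,g\})$ omits the last. A row shuffle of $\alpha\in Y_n(\{b,r,g,y\})$ is an array $\alpha'$ obtained by reordering the entries within each row of $\alpha$ such that $\alpha'\in Y_n(\{b,r,g\})$ (distinct arrays counted once). For an entry $\alpha_{i,j}$ with $j\ge 1$, its southwest diagonal neighbor is $\alpha_{i+1,j-1}$.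 $E_{i,k}(\alpha)$ is the number of entries of value $k$ in row $i$ equal to their southwest diagonal neighbor; $E_i(\alpha)=\sum_k E_{i,k}(\alpha)$; $E(\alpha)=\sum_i E_i(\alpha)$; $E^d(\alpha)$ is the number of entries $\alpha_{i,j}$ with $j\ge1$ and $i+j=d$ equal to their southwest diagonal neighbor; $C_{i,k}(\alpha)$ is the number of entries in row $i$ with value $k$. -}

module Defs where

open import Level using (0ℓ)
open import Data.Bool using (Bool; true; false; _∧_; if_then_else_)
open import Data.Nat using (ℕ; zero; suc; _+_; _∸_; _≤ᵇ_; _≡ᵇ_)
open import Data.Nat.Combinatorics using (_C_)
open import Data.List using (List; []; _∷_; map; concatMap; upTo; filterᵇ; length; foldr; _++_)
open import Data.Bool.ListAction using (all)
open import Data.Nat.ListAction using (sum)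
open import Data.Product using (_×_; _,_)
open import Algebra.Bundles using (CommutativeSemiring)
import Algebra.Definitions.RawSemiring as RS

-- Arrays α = (α_{i,j}), 1 ≤ i ≤ n, 0 ≤ j ≤ n-i, stored as a list of rows:
-- the (i-1)-th element of the outer list is row i, and its j-th element
-- is α_{i,j}.

Array : Set
Array = List (List ℕ)

ix : {A : Set} → A → List A → ℕ → A
ix d []       _       = d
ix d (x ∷ _)  zero    = x
ix d (_ ∷ xs) (suc k) = ix d xs k

row : Array → ℕ → List ℕ
row α i = ix [] α (i ∸ 1)

at : Array → ℕ → ℕ → ℕ
at α i j = ix 0 (row α i) j

range : ℕ → ℕ → List ℕ
range a b = map (a +_) (upTo (suc b ∸ a))

positions : ℕ → List (ℕ × ℕ)
positions n = concatMap (λ i → map (i ,_) (upTo (suc (n ∸ i)))) (range 1 n)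

-- Enumeration of all arrays of the right shape with i ≤ α_{i,j} ≤ i + j
-- (i.e. the condition g).  Each such array appears exactly once.

rowCands : ℕ → ℕ → ℕ → List (List ℕ)
rowCands i j zero    = [] ∷ []
rowCands i j (suc m) =
  concatMap (λ a → map (a ∷_) (rowCands i (suc j) m)) (range i (i + j))

-- arrays consisting of rows i, i+1, ..., i+k-1 where row i has length k
-- (so that, starting from i = 1 and k = n, row i has length n - i + 1)
arraysFrom : ℕ → ℕ → List Array
arraysFrom i zero    = [] ∷ []
arraysFrom i (suc k) =
  concatMap (λ r → map (r ∷_) (arraysFrom (suc i) k)) (rowCands i 0 (suc k))

gArrays : ℕ → List Array
gArrays n = arraysFrom 1 n

-- The conditions r, b, y (checked whenever all entries involved are defined)

_⇒ᵇ_ : Bool → Bool → Bool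
a ⇒ᵇ b = if a then b else true

rCond : ℕ → Array → Bool
rCond n α = all (λ { (i , j) → (2 ≤ᵇ i) ⇒ᵇ (at α i j ≤ᵇ suc (at α (i ∸ 1) (suc j))) }) (positions n)

bCond : ℕ → Array → Bool
bCond n α = all (λ { (i , j) → (1 ≤ᵇ j) ⇒ᵇ (at α i j ≤ᵇ at α (suc i) (j ∸ 1)) }) (positions n)

yCond : ℕ → Array → Bool
yCond n α = all (λ { (i , j) → (suc j ≤ᵇ n ∸ i) ⇒ᵇ (at α i j ≤ᵇ at α i (suc j)) }) (positions n)

Ybrgy : ℕ → List Array
Ybrgy n = filterᵇ (λ α → rCond n α ∧ bCond n α ∧ yCond n α) (gArrays n)

-- membership test for Y_n({b,r,g}) among arrays of gArrays n
inYbrg : ℕ → Array → Bool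
inYbrg n α = rCond n α ∧ bCond n α

count : ℕ → List ℕ → ℕ
count v xs = length (filterᵇ (v ≡ᵇ_) xs)

isReordering : List ℕ → List ℕ → Bool
isReordering r s =
  (length r ≡ᵇ length s) ∧ all (λ v → count v r ≡ᵇ count v s) (r ++ s)

rowwiseReordering : ℕ → Array → Array → Bool
rowwiseReordering n α α' = all (λ i → isReordering (row α i) (row α' i)) (range 1 n)

-- the row shuffles of α: the distinct arrays α' ∈ Y_n({b,r,g}) obtained by
-- reordering the entries within each row of α (each listed once)
rowShuffles : ℕ → Array → List Array
rowShuffles n α = filterᵇ (λ α' → inYbrg n α' ∧ rowwiseReordering n α α') (gArrays n)

-- α_{i,j} equals its southwest diagonal neighbour α_{i+1,j-1}  (for j ≥ 1)
diagEq : Array → ℕ → ℕ → Bool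
diagEq α i j = at α i j ≡ᵇ at α (suc i) (j ∸ 1)

Eik : ℕ → Array → ℕ → ℕ → ℕ
Eik n α i k = length (filterᵇ (λ j → diagEq α i j ∧ (at α i j ≡ᵇ k)) (range 1 (n ∸ i)))

Ei : ℕ → Array → ℕ → ℕ
Ei n α i = length (filterᵇ (λ j → diagEq α i j) (range 1 (n ∸ i)))

E : ℕ → Array → ℕ
E n α = sum (map (Ei n α) (range 1 n))

Ed : ℕ → Array → ℕ → ℕ
Ed n α d = length (filterᵇ (λ { (i , j) → (1 ≤ᵇ j) ∧ ((i + j) ≡ᵇ d) ∧ diagEq α i j }) (positions n))

Cik : Array → ℕ → ℕ → ℕ
Cik α i k = count k (row α i)

-- The two sides of the identities, evaluated in an arbitrary commutative
-- semiring R (the identities as polynomial identities in ℕ[x_1..x_n, λ]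
-- are equivalent to their validity in every commutative semiring).

module _ (R : CommutativeSemiring 0ℓ 0ℓ) where
  open CommutativeSemiring R using (Carrier; _*_; 0#; 1#; rawSemiring)
    renaming (_+_ to _+R_)
  open RS rawSemiring using (_^_) renaming (_×_ to _·ℕ_)

  ΣL : {A : Set} → List A → (A → Carrier) → Carrier
  ΣL xs f = foldr (λ a acc → f a +R acc) 0# xs

  ΠL : {A : Set} → List A → (A → Carrier) → Carrier
  ΠL xs f = foldr (λ a acc → f a * acc) 1# xs

  LHS₁ : ℕ → (ℕ → Carrier) → Carrier → Carrier
  LHS₁ n x l = ΠL (range 1 n) (λ j → ΠL (range 1 (j ∸ 1)) (λ i → x i +R (l * x j)))

  RHS₁ : ℕ → (ℕ → Carrier) → Carrier → Carrier
  RHS₁ n x l = ΣL (Ybrgy n) (λ α →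
      (l ^ E n α)
    * (ΠL (range 1 (n ∸ 1)) (λ i → x i ^ ((n ∸ i) ∸ Ei n α i))
    * ΣL (rowShuffles n α) (λ α' → ΠL (range 2 n) (λ d → x d ^ Ed n α' d))))

  LHS₂ : ℕ → Carrier → Carrier
  LHS₂ n l = (1# +R l) ^ (n C 2)

  RHS₂ : ℕ → Carrier → Carrier
  RHS₂ n l = ΣL (Ybrgy n) (λ α →
      (l ^ E n α)
    * ΠL (range 1 (n ∸ 1)) (λ i → ΠL (range i (n ∸ 1)) (λ k →
         (Cik α (suc i) k C Eik n α i k) ·ℕ 1#)))

{-# OPTIONS --safe #-}

-- An array lies in Y_n({b,r,g}) iff row i is i followed by entries a_1, a_2, ... with
-- a_j ∈ {b_j, b_j − 1}, where b_1, b_2, ... is row i + 1.  Giving the choice a_j = b_j the weight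
-- λ x_{i+j} and the choice a_j = b_j − 1 the weight x_i, the total weight of all arrays is
-- ∏_{i<j} (x_i + λ x_j), whatever the rows below are.  Sorting all rows preserves the relation
-- between consecutive rows, so every such array is a row shuffle of exactly one
-- α ∈ Y_n({b,r,g,y}); and E_i depends only on the row contents, because
-- Σ_j (b_j − a_j) = n − i − E_i.  Grouping by α gives the first identity.
--
-- For the second, put x = 1 and count the row shuffles of α from the last row upwards: given an
-- arrangement of row i + 1, the contents of row i prescribe for each value k how many of the
-- C_{i+1,k} entries k are copied, namely E_{i,k}, and these can be chosen freely.
module Submission where

open import Defs
open import Level using (0ℓ)
open import Function using (_∘_; const; _⇔_; mk⇔; Equivalence)
open import Data.Bool using (Bool; true; false; T; _∧_; if_then_else_)
open import Data.Bool.Properties using (T?; T-∧; T-≡; ∧-zeroʳ; ∧-identityʳ)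
open import Data.Bool.ListAction using (and)
open import Data.Empty using (⊥-elim)
open import Data.Nat using (ℕ; zero; suc; _+_; _*_; _∸_; _⊓_; _⊔_; _≤_; _<_; z≤n; s≤s; s≤s⁻¹; _≤ᵇ_; _≡ᵇ_)
open import Data.Nat.Combinatorics
open import Data.Nat.ListAction using (sum)
open import Data.Nat.ListAction.Properties using (sum-↭)
open import Data.Nat.Properties
open import Data.Nat.Tactic.RingSolver using (solve-∀)
open import Data.List using (List; []; _∷_; [_]; _++_; applyUpTo; concatMap; drop; filterᵇ; foldr; length; map; upTo)
open import Data.List.Properties using (length-filter; length-map; length-upTo; map-∘; map-upTo; upTo-∷ʳ)
open import Data.List.Membership.DecPropositional _≟_ using (_∈?_)
open import Data.List.Membership.Propositional using (_∈_; find; lose)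
open import Data.List.Membership.Propositional.Properties
open import Data.List.Membership.Propositional.Properties.WithK using (unique∧set⇒bag)
open import Data.List.Relation.Binary.BagAndSetEquality using (∼bag⇒↭)
open import Data.List.Relation.Binary.Permutation.Propositional
  using (_↭_; refl; prep; swap; trans; ↭-sym; ↭-trans; ↭-reflexive)
open import Data.List.Relation.Binary.Permutation.Propositional.Properties using (All-resp-↭; ↭-length; filter-↭)
open import Data.List.Relation.Binary.Pointwise using (Pointwise; []; _∷_; Pointwise-length)
open import Data.List.Relation.Unary.All as All using (All; []; _∷_)
open import Data.List.Relation.Unary.All.Properties using (all⁺; all⁻)
open import Data.List.Relation.Unary.AllPairs using (AllPairs; []; _∷_)
open import Data.List.Relation.Unary.Any using (here; there)
open import Data.List.Relation.Unary.Linked using (Linked; []; [-]; _∷_)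
open import Data.List.Relation.Unary.Linked.Properties using (Linked⇒AllPairs)
open import Data.List.Relation.Unary.Unique.Propositional using (Unique)
import Data.List.Relation.Unary.Unique.Propositional.Properties as Unique
open import Data.Product using (_×_; _,_; proj₁; proj₂; ∃)
open import Data.Sum using (inj₁; inj₂)
open import Relation.Binary.PropositionalEquality as ≡
  using (_≡_; _≢_; cong; cong₂; subst; subst₂; module ≡-Reasoning)
open import Relation.Nullary using (¬_; ¬?; contradiction; yes; no)
open import Relation.Nullary.Decidable using (decidable-stable)
open import Algebra.Bundles using (CommutativeMonoid; CommutativeSemiring)

-- The theorem filters arrays by Boolean tests on whole arrays, while both identities come from
-- reading an array as a chain of rows. A second enumeration, which chooses each row after the rows
-- below it, is a permutation of the filtered list, so every sum can be moved across. That contents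
-- prescribe the copied entries rests on one balance. Let a be row i without its leading entry and b
-- row i + 1. An entry v + 1 of b stems from a copied v + 1 or from a v of a that is not copied, so
-- count (v + 1) b + copies v = copies (v + 1) + count v a. With the contents of b known, it yields
-- the copies from the contents of a, upwards from v = 0, and the contents of a from the copies. The
-- number of arrangements must be computed for arbitrary prescribed copies e v, attainable or not:
-- the recursion behind Pascal's rule shortens b while e may stay the same, so e can exceed what b
-- offers.

private variable
  A B Z : Set

T⇒≡ : ∀ {b} → T b → b ≡ true
T⇒≡ = Equivalence.to T-≡

¬T⇒≡ : ∀ {b} → ¬ T b → b ≡ false
¬T⇒≡ {true}  ¬t = ⊥-elim (¬t _)
¬T⇒≡ {false} _  = ≡.refl

-- Iterated operations

module Fold (M : CommutativeMonoid 0ℓ 0ℓ) where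
  open CommutativeMonoid M renaming (refl to ≈-refl; sym to ≈-sym; trans to ≈-trans)
  open import Algebra.Properties.CommutativeSemigroup commutativeSemigroup
    using (interchange; x∙yz≈y∙xz)
  open import Algebra.Definitions.RawMonoid rawMonoid using () renaming (_×_ to _·_)
  open import Relation.Binary.Reasoning.Setoid setoid

  -- The same `foldr` as in `ΣL` and `ΠL`, so the sums and products of the theorem are instances by
  -- definition, and one set of lemmas serves both operations of ℕ and of the semiring.
  ⨁ : {A : Set} → List A → (A → Carrier) → Carrier
  ⨁ xs f = foldr (λ a acc → f a ∙ acc) ε xs

  private variable
    f g : A → Carrier

  ⨁-cong : (xs : List A) → (∀ {x} → x ∈ xs → f x ≈ g x) → ⨁ xs f ≈ ⨁ xs g
  ⨁-cong []       h = ≈-refl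
  ⨁-cong (x ∷ xs) h = ∙-cong (h (here ≡.refl)) (⨁-cong xs (h ∘ there))

  ⨁-ε : (xs : List A) → ⨁ xs (const ε) ≈ ε
  ⨁-ε []       = ≈-refl
  ⨁-ε (x ∷ xs) = ≈-trans (identityˡ _) (⨁-ε xs)

  ⨁-∙ : (xs : List A) → ⨁ xs f ∙ ⨁ xs g ≈ ⨁ xs (λ x → f x ∙ g x)
  ⨁-∙ []       = identityˡ ε
  ⨁-∙ (x ∷ xs) = ≈-trans (interchange _ _ _ _) (∙-congˡ (⨁-∙ xs))

  ⨁-map : (h : A → B) (xs : List A) → ⨁ (map h xs) f ≡ ⨁ xs (f ∘ h)
  ⨁-map h []       = ≡.refl
  ⨁-map h (x ∷ xs) = cong (_ ∙_) (⨁-map h xs)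

  ⨁-++ : (xs ys : List A) → ⨁ (xs ++ ys) f ≈ ⨁ xs f ∙ ⨁ ys f
  ⨁-++ []       ys = ≈-sym (identityˡ _)
  ⨁-++ (x ∷ xs) ys = ≈-trans (∙-congˡ (⨁-++ xs ys)) (≈-sym (assoc _ _ _))

  ⨁-concatMap : (h : A → List B) (xs : List A) → ⨁ (concatMap h xs) f ≈ ⨁ xs (λ x → ⨁ (h x) f)
  ⨁-concatMap h []       = ≈-refl
  ⨁-concatMap h (x ∷ xs) = ≈-trans (⨁-++ (h x) _) (∙-congˡ (⨁-concatMap h xs))

  ⨁-swap : {F : A → B → Carrier} (xs : List A) (ys : List B) →
           ⨁ xs (λ x → ⨁ ys (F x)) ≈ ⨁ ys (λ y → ⨁ xs (λ x → F x y))
  ⨁-swap []       ys = ≈-sym (⨁-ε ys)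
  ⨁-swap (x ∷ xs) ys = ≈-trans (∙-congˡ (⨁-swap xs ys)) (⨁-∙ ys)

  ⨁-filter : (p : A → Bool) (xs : List A) →
             ⨁ (filterᵇ p xs) f ≈ ⨁ xs (λ x → if p x then f x else ε)
  ⨁-filter p [] = ≈-refl
  ⨁-filter p (x ∷ xs) with p x
  ... | true  = ∙-congˡ (⨁-filter p xs)
  ... | false = ≈-trans (⨁-filter p xs) (≈-sym (identityˡ _))

  ⨁-↭ : {xs ys : List A} → xs ↭ ys → ⨁ xs f ≈ ⨁ ys f
  ⨁-↭ refl           = ≈-refl
  ⨁-↭ (prep x r)     = ∙-congˡ (⨁-↭ r)
  ⨁-↭ (swap x y r)   = ≈-trans (x∙yz≈y∙xz _ _ _) (∙-congˡ (∙-congˡ (⨁-↭ r)))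
  ⨁-↭ (trans r s)    = ≈-trans (⨁-↭ r) (⨁-↭ s)

  -- Used for two facts of uniqueness: a given array is a row shuffle of exactly one sorted array,
  -- and an entry lies on exactly one diagonal d.
  ⨁-single : {p : A → Bool} {a : A} (xs : List A) → Unique xs → a ∈ xs → T (p a) →
             (∀ {b} → b ∈ xs → T (p b) → b ≡ a) →
             ⨁ xs (λ x → if p x then f x else ε) ≈ f a
  ⨁-single {f = f} {p = p} {a} (x ∷ xs) (x∉ ∷ _) (here ≡.refl) pa only
    rewrite T⇒≡ pa = ≈-trans (∙-congˡ (≈-trans (⨁-cong xs off) (⨁-ε xs))) (identityʳ _)
    where
    off : ∀ {b} → b ∈ xs → (if p b then f b else ε) ≈ ε
    off {b} b∈ with p b in eq
    ... | false = ≈-refl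
    ... | true  = contradiction (≡.sym (only (there b∈) (subst T (≡.sym eq) _))) (All.lookup x∉ b∈)
  ⨁-single {p = p} {a} (x ∷ xs) (x∉ ∷ u) (there a∈) pa only with p x in eq
  ... | true  = contradiction (only (here ≡.refl) (subst T (≡.sym eq) _)) (All.lookup x∉ a∈)
  ... | false = ≈-trans (identityˡ _) (⨁-single xs u a∈ pa (only ∘ there))

  ⨁-upTo-suc : ∀ n f → ⨁ (upTo (suc n)) f ≡ f 0 ∙ ⨁ (upTo n) (f ∘ suc)
  ⨁-upTo-suc n f = cong (f 0 ∙_)
    (≡.trans (cong (λ xs → ⨁ xs f) (≡.sym (map-upTo suc n))) (⨁-map suc (upTo n)))

  ⨁-upTo-∷ʳ : ∀ n f → ⨁ (upTo (suc n)) f ≈ ⨁ (upTo n) f ∙ f n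
  ⨁-upTo-∷ʳ n f = begin
    ⨁ (upTo (suc n)) f        ≡⟨ cong (λ xs → ⨁ xs f) (upTo-∷ʳ n) ⟨
    ⨁ (upTo n ++ [ n ]) f     ≈⟨ ⨁-++ (upTo n) [ n ] ⟩
    ⨁ (upTo n) f ∙ (f n ∙ ε)  ≈⟨ ∙-congˡ (identityʳ _) ⟩
    ⨁ (upTo n) f ∙ f n        ∎

  -- In a multiplicative monoid `·` is a power, so an exponent that counts hits becomes a product
  -- over all positions.
  ⨁-·-filter : ∀ (p : A → Bool) c (xs : List A) →
               length (filterᵇ p xs) · c ≈ ⨁ xs (λ x → if p x then c else ε)
  ⨁-·-filter p c [] = ≈-refl
  ⨁-·-filter p c (x ∷ xs) with p x
  ... | true  = ∙-congˡ (⨁-·-filter p c xs)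
  ... | false = ≈-trans (⨁-·-filter p c xs) (≈-sym (identityˡ _))

  ⨁-upTo-+ : ∀ m n f → ⨁ (upTo (m + n)) f ≈ ⨁ (upTo m) f ∙ ⨁ (upTo n) (f ∘ (m +_))
  ⨁-upTo-+ zero    n f = ≈-sym (identityˡ _)
  ⨁-upTo-+ (suc m) n f = begin
    ⨁ (upTo (suc m + n)) f  ≡⟨ ⨁-upTo-suc (m + n) f ⟩
    f 0 ∙ ⨁ (upTo (m + n)) (f ∘ suc)  ≈⟨ ∙-congˡ (⨁-upTo-+ m n (f ∘ suc)) ⟩
    f 0 ∙ (⨁ (upTo m) (f ∘ suc) ∙ ⨁ (upTo n) (f ∘ (suc m +_)))  ≈⟨ assoc _ _ _ ⟨
    f 0 ∙ ⨁ (upTo m) (f ∘ suc) ∙ ⨁ (upTo n) (f ∘ (suc m +_))  ≡⟨ cong (_∙ ⨁ (upTo n) (f ∘ (suc m +_))) (⨁-upTo-suc m f) ⟨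
    ⨁ (upTo (suc m)) f ∙ ⨁ (upTo n) (f ∘ (suc m +_))  ∎

  ⨁-const : ∀ c (xs : List A) → ⨁ xs (const c) ≈ length xs · c
  ⨁-const c []       = ≈-refl
  ⨁-const c (x ∷ xs) = ∙-congˡ (⨁-const c xs)

  ⨁-·-complement : ∀ (p : A → Bool) c (xs : List A) →
    (length xs ∸ length (filterᵇ p xs)) · c ≈ ⨁ xs (λ x → if p x then ε else c)
  ⨁-·-complement p c [] = ≈-refl
  ⨁-·-complement p c (x ∷ xs) with p x
  ... | true  = ≈-trans (⨁-·-complement p c xs) (≈-sym (identityˡ _))
  -- `length-filter` bounds the subtrahend, so truncated subtraction is exact here and a miss adds
  -- one to the exponent.
  ... | false rewrite +-∸-assoc 1 (length-filter (T? ∘ p) xs) = ∙-congˡ (⨁-·-complement p c xs)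

  -- The pairs i < j < n, grouped by the larger index on the left and by the smaller one, with the
  -- distance as second index, on the right. The induction splits off the pairs with i = 0.
  ⨁-triangle : ∀ n (F : ℕ → ℕ → Carrier) →
    ⨁ (upTo n) (λ j → ⨁ (upTo j) (λ i → F i j)) ≈
    ⨁ (upTo n) (λ i → ⨁ (upTo (n ∸ suc i)) (λ j → F i (suc (i + j))))
  ⨁-triangle zero    F = ≈-refl
  ⨁-triangle (suc n) F = begin
    ⨁ (upTo (suc n)) (λ j → ⨁ (upTo j) (λ i → F i j))
      ≡⟨ ⨁-upTo-suc n (λ j → ⨁ (upTo j) (λ i → F i j)) ⟩
    ε ∙ ⨁ (upTo n) (λ j → ⨁ (upTo (suc j)) (λ i → F i (suc j)))
      ≈⟨ identityˡ _ ⟩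
    ⨁ (upTo n) (λ j → ⨁ (upTo (suc j)) (λ i → F i (suc j)))
      ≈⟨ ⨁-cong (upTo n) (λ {j} _ → reflexive (⨁-upTo-suc j (λ i → F i (suc j)))) ⟩
    ⨁ (upTo n) (λ j → F 0 (suc j) ∙ ⨁ (upTo j) (λ i → F (suc i) (suc j)))
      ≈⟨ ⨁-∙ (upTo n) ⟨
    ⨁ (upTo n) (λ j → F 0 (suc j)) ∙ ⨁ (upTo n) (λ j → ⨁ (upTo j) (λ i → F (suc i) (suc j)))
      ≈⟨ ∙-congˡ (⨁-triangle n (λ i j → F (suc i) (suc j))) ⟩
    ⨁ (upTo n) (λ j → F 0 (suc j)) ∙
      ⨁ (upTo n) (λ i → ⨁ (upTo (n ∸ suc i)) (λ j → F (suc i) (suc (suc i + j))))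
      ≡⟨ ⨁-upTo-suc n (λ i → ⨁ (upTo (suc n ∸ suc i)) (λ j → F i (suc (i + j)))) ⟨
    ⨁ (upTo (suc n)) (λ i → ⨁ (upTo (suc n ∸ suc i)) (λ j → F i (suc (i + j)))) ∎

-- Membership and uniqueness in the enumerations

ix-pointwise : {R : A → B → Set} (d : A) (e : B) {xs : List A} {ys : List B} → Pointwise R xs ys →
               ∀ j → j < length xs → R (ix d xs j) (ix e ys j)
ix-pointwise d e (r ∷ rs) zero    _         = r
ix-pointwise d e (r ∷ rs) (suc j) (s≤s j<n) = ix-pointwise d e rs j j<n

pointwise-ix : {R : A → B → Set} (d : A) (e : B) {xs : List A} {ys : List B} → length xs ≡ length ys →
               (∀ j → j < length xs → R (ix d xs j) (ix e ys j)) → Pointwise R xs ys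
pointwise-ix d e {[]}     {[]}     _  h = []
pointwise-ix d e {x ∷ xs} {y ∷ ys} eq h =
  h 0 (s≤s z≤n) ∷ pointwise-ix d e (suc-injective eq) (λ j j<n → h (suc j) (s≤s j<n))

ix-map : (f : A → A) (d : A) → f d ≡ d → ∀ xs j → ix d (map f xs) j ≡ f (ix d xs j)
ix-map f d fd []       j       = ≡.sym fd
ix-map f d fd (x ∷ xs) zero    = ≡.refl
ix-map f d fd (x ∷ xs) (suc j) = ix-map f d fd xs j

∈-concatMap-map⁺ : {g : A → B → Z} {f : A → List B} {xs : List A} {x : A} {y : B} →
                   x ∈ xs → y ∈ f x → g x y ∈ concatMap (λ x → map (g x) (f x)) xs
∈-concatMap-map⁺ {g = g} {f} x∈ y∈ = ∈-concatMap⁺ (λ x → map (g x) (f x)) (lose x∈ (∈-map⁺ _ y∈))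

∈-concatMap-map⁻ : {g : A → B → Z} {f : A → List B} (xs : List A) {z : Z} →
                   z ∈ concatMap (λ x → map (g x) (f x)) xs →
                   ∃ λ x → ∃ λ y → x ∈ xs × y ∈ f x × z ≡ g x y
∈-concatMap-map⁻ {g = g} {f} xs z∈ with find (∈-concatMap⁻ (λ x → map (g x) (f x)) {xs = xs} z∈)
... | x , x∈ , z∈′ with ∈-map⁻ _ z∈′
... | y , y∈ , eq = x , y , x∈ , y∈ , eq

-- Blocks for different x are disjoint because `g` determines x; within a block it determines y. The
-- enumerations of rows and of arrays all have this form.
unique-concatMap-map : {g : A → B → Z} {f : A → List B} →
  (∀ {x x′ y y′} → g x y ≡ g x′ y′ → x ≡ x′ × y ≡ y′) →
  {xs : List A} → Unique xs → (∀ x → Unique (f x)) →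
  Unique (concatMap (λ x → map (g x) (f x)) xs)
unique-concatMap-map inj [] uf = []
unique-concatMap-map {g = g} inj {x ∷ xs} (x∉ ∷ u) uf =
  Unique.++⁺ (Unique.map⁺ (proj₂ ∘ inj) (uf x)) (unique-concatMap-map inj u uf) disjoint
  where
  disjoint : ∀ {z} → ¬ (z ∈ map (g x) _ × z ∈ concatMap (λ x → map (g x) _) xs)
  disjoint (z∈ , z∈′) with ∈-map⁻ _ z∈ | ∈-concatMap-map⁻ xs z∈′
  ... | y , _ , eq | x′ , y′ , x′∈ , _ , eq′ =
    All.lookup x∉ x′∈ (proj₁ (inj (≡.trans (≡.sym eq) eq′)))

∈-range⁺ : ∀ {a b v} → a ≤ v → v ≤ b → v ∈ range a b
∈-range⁺ {a} {b} a≤v v≤b =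
  subst (_∈ range a b) (m+[n∸m]≡n a≤v) (∈-map⁺ (a +_) (∈-upTo⁺ (∸-monoˡ-< (s≤s v≤b) a≤v)))

∈-range⁻ : ∀ {a b v} → v ∈ range a b → a ≤ v × v ≤ b
∈-range⁻ {a} {b} v∈ with ∈-map⁻ (a +_) v∈
... | t , t∈ , ≡.refl = m≤m+n a t ,
  s≤s⁻¹ (subst (_≤ suc b) (≡.cong suc (+-comm t a)) (m≤n∸o⇒m+o≤n {o = a} (∈-upTo⁻ t∈)))
  where
  m≤n∸o⇒m+o≤n : ∀ {m n o} → suc m ≤ n ∸ o → suc m + o ≤ n
  m≤n∸o⇒m+o≤n {m} {n} {o} le = ≤-trans (+-monoˡ-≤ o le)
    (≤-reflexive (m∸n+n≡m {n} {o} (<⇒≤ (m∸n≢0⇒n<m (λ eq → n≮0 (subst (suc m ≤_) eq le))))))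

unique-range : ∀ a b → Unique (range a b)
unique-range a b = Unique.map⁺ (+-cancelˡ-≡ a _ _) (Unique.upTo⁺ _)

∈-positions⁺ : ∀ {n i j} → 1 ≤ i → i ≤ n → j ≤ n ∸ i → (i , j) ∈ positions n
∈-positions⁺ 1≤i i≤n j≤ = ∈-concatMap-map⁺ {g = _,_} (∈-range⁺ 1≤i i≤n) (∈-upTo⁺ (s≤s j≤))

∈-positions⁻ : ∀ {n i j} → (i , j) ∈ positions n → 1 ≤ i × i ≤ n × j ≤ n ∸ i
∈-positions⁻ {n} p∈ with ∈-concatMap-map⁻ {g = _,_} (range 1 n) p∈
... | i , j , i∈ , j∈ , ≡.refl =
  proj₁ (∈-range⁻ i∈) , proj₂ (∈-range⁻ {1} {n} i∈) , s≤s⁻¹ (∈-upTo⁻ j∈)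

data Bounded (i : ℕ) : ℕ → List ℕ → Set where
  []  : ∀ {j} → Bounded i j []
  _∷_ : ∀ {j a r} → i ≤ a × a ≤ i + j → Bounded i (suc j) r → Bounded i j (a ∷ r)

data Shape : ℕ → ℕ → Array → Set where
  []    : ∀ {i} → Shape i 0 []
  layer : ∀ {i k r α} → length r ≡ suc k → Bounded i 0 r → Shape (suc i) k α → Shape i (suc k) (r ∷ α)

∈-rowCands⁺ : ∀ {i j m r} → length r ≡ m → Bounded i j r → r ∈ rowCands i j m
∈-rowCands⁺ {m = zero}  ≡.refl []       = here ≡.refl
∈-rowCands⁺ {m = suc m} eq     (ab ∷ b) =
  ∈-concatMap-map⁺ (∈-range⁺ (proj₁ ab) (proj₂ ab)) (∈-rowCands⁺ (suc-injective eq) b)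

∈-rowCands⁻ : ∀ {i j} m {r} → r ∈ rowCands i j m → length r ≡ m × Bounded i j r
∈-rowCands⁻ zero (here ≡.refl) = ≡.refl , []
∈-rowCands⁻ {i} {j} (suc m) r∈ with ∈-concatMap-map⁻ (range i (i + j)) r∈
... | a , r , a∈ , r∈′ , ≡.refl with ∈-rowCands⁻ m r∈′
... | len , b = cong suc len , ∈-range⁻ a∈ ∷ b

∈-arraysFrom⁺ : ∀ {i k α} → Shape i k α → α ∈ arraysFrom i k
∈-arraysFrom⁺ []              = here ≡.refl
∈-arraysFrom⁺ (layer len b s) = ∈-concatMap-map⁺ (∈-rowCands⁺ len b) (∈-arraysFrom⁺ s)

∈-arraysFrom⁻ : ∀ {i} k {α} → α ∈ arraysFrom i k → Shape i k α
∈-arraysFrom⁻ zero (here ≡.refl) = []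
∈-arraysFrom⁻ {i} (suc k) α∈ with ∈-concatMap-map⁻ (rowCands i 0 (suc k)) α∈
... | r , α , r∈ , α∈′ , ≡.refl with ∈-rowCands⁻ (suc k) r∈
... | len , b = layer len b (∈-arraysFrom⁻ k α∈′)

∷-inj : {x y : A} {xs ys : List A} → x ∷ xs ≡ y ∷ ys → x ≡ y × xs ≡ ys
∷-inj ≡.refl = ≡.refl , ≡.refl

unique-rowCands : ∀ i j m → Unique (rowCands i j m)
unique-rowCands i j zero    = [] ∷ []
unique-rowCands i j (suc m) =
  unique-concatMap-map ∷-inj (unique-range i (i + j)) (λ _ → unique-rowCands i (suc j) m)

unique-arraysFrom : ∀ i k → Unique (arraysFrom i k)
unique-arraysFrom i zero    = [] ∷ []
unique-arraysFrom i (suc k) =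
  unique-concatMap-map ∷-inj (unique-rowCands i 0 (suc k)) (λ _ → unique-arraysFrom (suc i) k)

-- Conditions b and r as a relation between consecutive rows

Step : ℕ → ℕ → Set
Step a b = a ≤ b × b ≤ suc a

-- Entry α_{i,j} with j ≥ 1 decides between x_i and λ x_{i+j}, like a match between players i and i
-- + j. The bounds force α_{i,0} = i; below the last row the default `[]` forces an empty tail.
data Tournament : ℕ → ℕ → Array → Set where
  []    : ∀ {i} → Tournament i 0 []
  layer : ∀ {i k a α} → Pointwise Step a (ix [] α 0) → Tournament (suc i) k α →
          Tournament i (suc k) ((i ∷ a) ∷ α)

length-row : ∀ {i k α} → Tournament i k α → ∀ t → length (ix [] α t) ≡ k ∸ t
length-row []          zero    = ≡.refl
length-row []          (suc t) = ≡.refl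
length-row (layer p τ) zero    = cong suc (≡.trans (Pointwise-length p) (length-row τ 0))
length-row (layer p τ) (suc t) = length-row τ t

Step-All : ∀ {v a b} → Pointwise Step a b → All (suc v ≤_) b → All (v ≤_) a
Step-All []            []         = []
Step-All ((_ , s) ∷ p) (v<b ∷ bs) = s≤s⁻¹ (≤-trans v<b s) ∷ Step-All p bs

row≥ : ∀ {i k α} → Tournament i k α → All (i ≤_) (ix [] α 0)
row≥ []          = []
row≥ (layer p τ) = ≤-refl ∷ Step-All p (row≥ τ)

-- Going up one row lowers an entry by at most one, as does the lower bound; the upper bound is
-- constant along a diagonal, since (i + 1) + j = i + (j + 1). Hence condition g follows from the
-- steps.
Step-Bounded : ∀ {i j a b} → Pointwise Step a b → Bounded (suc i) j b → Bounded i (suc j) a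
Step-Bounded [] [] = []
Step-Bounded {i} {j} ((a≤b , b≤a) ∷ p) ((i<b , b≤) ∷ bs) =
  (s≤s⁻¹ (≤-trans i<b b≤a) , ≤-trans a≤b (≤-trans b≤ (≤-reflexive (≡.sym (+-suc i j))))) ∷ Step-Bounded p bs

row-Bounded : ∀ {i k α} → Tournament i k α → Bounded i 0 (ix [] α 0)
row-Bounded []          = []
row-Bounded (layer p τ) =
  (≤-refl , ≤-reflexive (≡.sym (+-identityʳ _))) ∷ Step-Bounded p (row-Bounded τ)

Tournament⇒Shape : ∀ {i k α} → Tournament i k α → Shape i k α
Tournament⇒Shape []            = []
Tournament⇒Shape τ@(layer p σ) = layer (length-row τ 0) (row-Bounded τ) (Tournament⇒Shape σ)

-- Conditions b and r, read at the same pair α_{t+1,j+1} and α_{t+2,j}; t counts rows from 0.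
Diagonal : ℕ → Array → Set
Diagonal k α = ∀ t j → j < k ∸ suc t → Step (ix 0 (ix [] α t) (suc j)) (ix 0 (ix [] α (suc t)) j)

Tournament⇒Diagonal : ∀ {i k α} → Tournament i k α → Diagonal k α
Tournament⇒Diagonal (layer p τ) zero    j j< =
  ix-pointwise 0 0 p j (subst (j <_) (≡.sym (≡.trans (Pointwise-length p) (length-row τ 0))) j<)
Tournament⇒Diagonal (layer p τ) (suc t) j j< = Tournament⇒Diagonal τ t j j<

length-first : ∀ {i k α} → Shape i k α → length (ix [] α 0) ≡ k
length-first []              = ≡.refl
length-first (layer len _ _) = len

Diagonal⇒Tournament : ∀ {i k α} → Shape i k α → Diagonal k α → Tournament i k α
Diagonal⇒Tournament [] _ = []
Diagonal⇒Tournament {i} {suc k} (layer {r = a ∷ r} len ((i≤a , a≤i) ∷ _) s) d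
  with ≤-antisym i≤a (≤-trans a≤i (≤-reflexive (+-identityʳ i)))
... | ≡.refl = layer
  (pointwise-ix 0 0 (≡.trans len′ (≡.sym (length-first s))) (λ j j< → d 0 j (subst (j <_) len′ j<)))
  (Diagonal⇒Tournament s (λ t → d (suc t)))
  where
  len′ : length r ≡ k
  len′ = suc-injective len

⇒ᵇ-elim : ∀ {a b} → T (a ⇒ᵇ b) → T a → T b
⇒ᵇ-elim {true} tb _ = tb

⇒ᵇ-intro : ∀ {a b} → (T a → T b) → T (a ⇒ᵇ b)
⇒ᵇ-intro {true}  f = f _
⇒ᵇ-intro {false} f = _

m<n∸1+o⇒1+o≤n : ∀ {m n o} → m < n ∸ suc o → suc o < n
m<n∸1+o⇒1+o≤n {m} {n} {o} lt = m∸n≢0⇒n<m (λ eq → n≮0 (subst (m <_) eq lt))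

m<n∸o⇒m≤n∸1+o : ∀ {m n} o → m < n ∸ o → m ≤ n ∸ suc o
m<n∸o⇒m≤n∸1+o {m} {n} o lt = subst (m ≤_) (pred[m∸n]≡m∸[1+n] n o) (<⇒≤pred lt)

m≤n∸1+o⇒m<n∸o : ∀ {m n} o → o < n → m ≤ n ∸ suc o → m < n ∸ o
m≤n∸1+o⇒m<n∸o {m} {n} o o<n le =
  subst (m <_) (≡.sym (+-∸-assoc 1 o<n)) (s≤s le)

inYbrg⇒Diagonal : ∀ n α → T (inYbrg n α) → Diagonal n α
inYbrg⇒Diagonal n α h t j j< =
  ≤ᵇ⇒≤ _ _ (⇒ᵇ-elim (All.lookup (all⁺ _ (positions n) (proj₂ rb))
                      (∈-positions⁺ (s≤s z≤n) (<⇒≤ t<n) j<)) _) ,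
  ≤ᵇ⇒≤ _ _ (⇒ᵇ-elim (All.lookup (all⁺ _ (positions n) (proj₁ rb))
                      (∈-positions⁺ (s≤s z≤n) t<n (m<n∸o⇒m≤n∸1+o {n = n} (suc t) j<))) _)
  where
  rb = Equivalence.to (T-∧ {rCond n α}) h
  t<n : suc t < n
  t<n = m<n∸1+o⇒1+o≤n {n = n} j<

Diagonal⇒inYbrg : ∀ n α → Diagonal n α → T (inYbrg n α)
Diagonal⇒inYbrg n α d = Equivalence.from T-∧
  ( all⁻ _ (All.tabulate (λ {p} p∈ → ⇒ᵇ-intro (r (proj₁ p) (proj₂ p) (∈-positions⁻ p∈))))
  , all⁻ _ (All.tabulate (λ {p} p∈ → ⇒ᵇ-intro (b (proj₁ p) (proj₂ p) (∈-positions⁻ p∈)))))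
  where
  r : ∀ i j → 1 ≤ i × i ≤ n × j ≤ n ∸ i → T (2 ≤ᵇ i) → T (at α i j ≤ᵇ suc (at α (i ∸ 1) (suc j)))
  r (suc (suc t)) j (_ , i≤n , j≤) _ = ≤⇒≤ᵇ (proj₂ (d t j (m≤n∸1+o⇒m<n∸o (suc t) i≤n j≤)))
  b : ∀ i j → 1 ≤ i × i ≤ n × j ≤ n ∸ i → T (1 ≤ᵇ j) → T (at α i j ≤ᵇ at α (suc i) (j ∸ 1))
  b (suc t) (suc j) (_ , _ , j≤) _ = ≤⇒≤ᵇ (proj₁ (d t j j≤))

-- Sorting rows

Sorted : List ℕ → Set
Sorted = AllPairs _≤_

ix⇒Linked : ∀ r → (∀ j → suc j < length r → ix 0 r j ≤ ix 0 r (suc j)) → Linked _≤_ r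
ix⇒Linked []          h = []
ix⇒Linked (x ∷ [])    h = [-]
ix⇒Linked (x ∷ y ∷ r) h = h 0 (s≤s (s≤s z≤n)) ∷ ix⇒Linked (y ∷ r) (λ j lt → h (suc j) (s≤s lt))

Sorted⇒ix : ∀ {r} → Sorted r → ∀ j → suc j < length r → ix 0 r j ≤ ix 0 r (suc j)
Sorted⇒ix {x ∷ []}    _              zero    (s≤s ())
Sorted⇒ix {x ∷ y ∷ r} ((x≤y ∷ _) ∷ _) zero    _        = x≤y
Sorted⇒ix {x ∷ r}     (_ ∷ s)        (suc j) (s≤s lt) = Sorted⇒ix s j lt

yCond⇒Sorted : ∀ {n i α} → Tournament i n α → T (yCond n α) → ∀ t → t < n → Sorted (ix [] α t)
yCond⇒Sorted {n} {i} {α} τ y t t<n = Linked⇒AllPairs ≤-trans (ix⇒Linked (ix [] α t) λ j j< →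
  let j<′ = m<n∸o⇒m≤n∸1+o {n = n} t (subst (suc j <_) (length-row τ t) j<) in
  ≤ᵇ⇒≤ _ _ (⇒ᵇ-elim (All.lookup (all⁺ _ (positions n) y)
    (∈-positions⁺ (s≤s z≤n) t<n (<⇒≤ j<′))) (≤⇒≤ᵇ j<′)))

Sorted⇒yCond : ∀ {n i α} → Tournament i n α → (∀ t → t < n → Sorted (ix [] α t)) → T (yCond n α)
Sorted⇒yCond {n} {_} {α} τ s =
  all⁻ _ (All.tabulate (λ {p} p∈ → ⇒ᵇ-intro (y (proj₁ p) (proj₂ p) (∈-positions⁻ p∈))))
  where
  y : ∀ i j → 1 ≤ i × i ≤ n × j ≤ n ∸ i → T (suc j ≤ᵇ n ∸ i) → T (at α i j ≤ᵇ at α i (suc j))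
  y (suc t) j (_ , t<n , _) j< = ≤⇒≤ᵇ (Sorted⇒ix (s t t<n) j
    (subst (suc j <_) (≡.sym (length-row τ t)) (m≤n∸1+o⇒m<n∸o t t<n (≤ᵇ⇒≤ _ _ j<))))

-- Written with ⊓ and ⊔, insertion is visibly monotone for Step in both arguments.
insert : ℕ → List ℕ → List ℕ
insert x []       = x ∷ []
insert x (y ∷ ys) = x ⊓ y ∷ insert (x ⊔ y) ys

sort : List ℕ → List ℕ
sort = foldr insert []

-- The half b ≤ a + 1 is monotonicity too, because `⊓` and `⊔` compute through a `suc` on both
-- arguments.
insert-Step : ∀ {x y xs ys} → Step x y → Pointwise Step xs ys → Pointwise Step (insert x xs) (insert y ys)
insert-Step s []      = s ∷ []
insert-Step (x≤y , y≤x) ((a≤b , b≤a) ∷ p) =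
  (⊓-mono-≤ x≤y a≤b , ⊓-mono-≤ y≤x b≤a) ∷ insert-Step (⊔-mono-≤ x≤y a≤b , ⊔-mono-≤ y≤x b≤a) p

sort-Step : ∀ {xs ys} → Pointwise Step xs ys → Pointwise Step (sort xs) (sort ys)
sort-Step []      = []
sort-Step (s ∷ p) = insert-Step s (sort-Step p)

insert-↭ : ∀ x ys → insert x ys ↭ x ∷ ys
insert-↭ x []       = refl
insert-↭ x (y ∷ ys) with ≤-total x y
... | inj₁ x≤y rewrite m≤n⇒m⊓n≡m x≤y | m≤n⇒m⊔n≡n x≤y = prep x (insert-↭ y ys)
... | inj₂ y≤x rewrite m≥n⇒m⊓n≡n y≤x | m≥n⇒m⊔n≡m y≤x =
  trans (prep y (insert-↭ x ys)) (swap y x refl)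

sort-↭ : ∀ xs → sort xs ↭ xs
sort-↭ []       = refl
sort-↭ (x ∷ xs) = trans (insert-↭ x (sort xs)) (prep x (sort-↭ xs))

insert-Sorted : ∀ x {ys} → Sorted ys → Sorted (insert x ys)
insert-Sorted x []                 = [] ∷ []
insert-Sorted x {y ∷ ys} (y≤ ∷ s) =
  All-resp-↭ (↭-sym (insert-↭ (x ⊔ y) ys))
    (≤-trans (m⊓n≤m x y) (m≤m⊔n x y) ∷ All.map (≤-trans (m⊓n≤n x y)) y≤)
  ∷ insert-Sorted (x ⊔ y) s

sort-Sorted : ∀ xs → Sorted (sort xs)
sort-Sorted []       = []
sort-Sorted (x ∷ xs) = insert-Sorted x (sort-Sorted xs)

-- Contents of rows as multisets

infix 4 _≋_
-- Counts are what `isReordering` tests and what the binomials contain, and a common head cancels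
-- from them by arithmetic.
_≋_ : List ℕ → List ℕ → Set
r ≋ s = ∀ v → count v r ≡ count v s

↭⇒≋ : ∀ {r s} → r ↭ s → r ≋ s
↭⇒≋ p v = ↭-length (filter-↭ (T? ∘ (v ≡ᵇ_)) p)

count-∷ : ∀ v x xs → count v (x ∷ xs) ≡ (if v ≡ᵇ x then 1 else 0) + count v xs
count-∷ v x xs with v ≡ᵇ x
... | true  = ≡.refl
... | false = ≡.refl

count>0⇒∈ : ∀ {v r} → 0 < count v r → v ∈ r
count>0⇒∈ {v} {r} lt with filterᵇ (v ≡ᵇ_) r in eq
... | w ∷ _ with ∈-filter⁻ (T? ∘ (v ≡ᵇ_)) {xs = r} (subst (w ∈_) (≡.sym eq) (here ≡.refl))
... | w∈ , v≡w = subst (_∈ r) (≡.sym (≡ᵇ⇒≡ v w v≡w)) w∈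

∈⇒count>0 : ∀ {v r} → v ∈ r → 0 < count v r
∈⇒count>0 {v} {r} v∈ = ∈-length (∈-filter⁺ (T? ∘ (v ≡ᵇ_)) v∈ (≡⇒≡ᵇ v v ≡.refl))

count≡0 : ∀ {v r} → (∀ {w} → w ∈ r → w ≢ v) → count v r ≡ 0
count≡0 {v} {r} h with count v r in eq
... | zero  = ≡.refl
... | suc _ = contradiction ≡.refl (h (count>0⇒∈ {v} {r} (subst (0 <_) (≡.sym eq) (s≤s z≤n))))

Sorted-∈ : ∀ {x y ys} → Sorted (y ∷ ys) → x ∈ y ∷ ys → y ≤ x
Sorted-∈ _        (here ≡.refl) = ≤-refl
Sorted-∈ (y≤ ∷ _) (there x∈)    = All.lookup y≤ x∈

≋-∈ : ∀ {r s v} → r ≋ s → v ∈ r → v ∈ s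
≋-∈ {v = v} eq v∈ = count>0⇒∈ (subst (0 <_) (eq v) (∈⇒count>0 v∈))

-- Each head is the minimum of its list and occurs in the other list, so the heads agree; then they
-- cancel from the counts.
Sorted-unique : ∀ {r s} → Sorted r → Sorted s → r ≋ s → r ≡ s
Sorted-unique {[]}    {[]}    _ _ _ = ≡.refl
Sorted-unique {[]}    {y ∷ s} _ _ eq with () ← ≋-∈ {y ∷ s} {[]} (≡.sym ∘ eq) (here ≡.refl)
Sorted-unique {x ∷ r} {[]}    _ _ eq with () ← ≋-∈ {x ∷ r} {[]} eq (here ≡.refl)
Sorted-unique {x ∷ r} {y ∷ s} xr ys eq
  with ≤-antisym (Sorted-∈ xr (≋-∈ {y ∷ s} {x ∷ r} (≡.sym ∘ eq) (here ≡.refl)))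
                 (Sorted-∈ ys (≋-∈ {x ∷ r} {y ∷ s} eq (here ≡.refl)))
Sorted-unique {x ∷ r} {x ∷ s} (_ ∷ xr) (_ ∷ ys) eq | ≡.refl = cong (x ∷_) (Sorted-unique xr ys λ v →
  +-cancelˡ-≡ (if v ≡ᵇ x then 1 else 0) _ _
    (≡.trans (≡.sym (count-∷ v x r)) (≡.trans (eq v) (count-∷ v x s))))

≋⇒↭ : ∀ r s → r ≋ s → r ↭ s
≋⇒↭ r s eq = ↭-trans (↭-sym (sort-↭ r)) (↭-trans (↭-reflexive (Sorted-unique (sort-Sorted r) (sort-Sorted s)
  (λ v → ≡.trans (↭⇒≋ (sort-↭ r) v) (≡.trans (eq v) (≡.sym (↭⇒≋ (sort-↭ s) v)))))) (sort-↭ s))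

isReordering⇒≋ : ∀ r s → T (isReordering r s) → r ≋ s
isReordering⇒≋ r s h v with v ∈? r ++ s
... | yes v∈ = ≡ᵇ⇒≡ _ _ (All.lookup
  (all⁺ _ (r ++ s) (proj₂ (Equivalence.to (T-∧ {length r ≡ᵇ length s}) h))) v∈)
-- The test looks only at values in r ++ s; any other value has count 0 on both sides.
... | no  v∉ = ≡.trans
  (count≡0 {v} {r} (λ { w∈ ≡.refl → v∉ (∈-++⁺ˡ w∈) }))
  (≡.sym (count≡0 {v} {s} (λ { w∈ ≡.refl → v∉ (∈-++⁺ʳ r w∈) })))

≋⇒isReordering : ∀ r s → r ≋ s → T (isReordering r s)
≋⇒isReordering r s eq = Equivalence.from T-∧
  ( ≡⇒≡ᵇ _ _ (↭-length (≋⇒↭ r s eq))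
  , all⁻ _ (All.tabulate {xs = r ++ s} (λ {v} _ → ≡⇒≡ᵇ (count v r) (count v s) (eq v))))

Shuffle : ℕ → Array → Array → Set
Shuffle n α α′ = ∀ t → t < n → ix [] α t ≋ ix [] α′ t

reordering⇒Shuffle : ∀ n α α′ → T (rowwiseReordering n α α′) → Shuffle n α α′
reordering⇒Shuffle n α α′ h t t<n =
  isReordering⇒≋ (ix [] α t) (ix [] α′ t) (All.lookup (all⁺ _ (range 1 n) h) (∈-range⁺ (s≤s z≤n) t<n))

Shuffle⇒reordering : ∀ n α α′ → Shuffle n α α′ → T (rowwiseReordering n α α′)
Shuffle⇒reordering n α α′ h = all⁻ _ (All.tabulate (λ {i} i∈ → go i (∈-range⁻ {1} {n} i∈)))
  where
  go : ∀ i → 1 ≤ i × i ≤ n → T (isReordering (row α i) (row α′ i))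
  go (suc t) (_ , t<n) = ≋⇒isReordering (ix [] α t) (ix [] α′ t) (h t t<n)

∈-Ybrgy⁻ : ∀ {n α} → α ∈ Ybrgy n → Tournament 1 n α × (∀ t → t < n → Sorted (ix [] α t))
∈-Ybrgy⁻ {n} {α} α∈ with ∈-filter⁻ (T? ∘ λ α → rCond n α ∧ bCond n α ∧ yCond n α) {xs = gArrays n} α∈
... | α∈g , rby with Equivalence.to (T-∧ {rCond n α}) rby
... | r , by with Equivalence.to (T-∧ {bCond n α}) by
... | b , y = τ , yCond⇒Sorted τ y
  where
  τ : Tournament 1 n α
  τ = Diagonal⇒Tournament (∈-arraysFrom⁻ n α∈g) (inYbrg⇒Diagonal n α (Equivalence.from T-∧ (r , b)))

∈-Ybrgy⁺ : ∀ {n α} → Tournament 1 n α → (∀ t → t < n → Sorted (ix [] α t)) → α ∈ Ybrgy n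
∈-Ybrgy⁺ {n} {α} τ s = ∈-filter⁺ (T? ∘ λ α → rCond n α ∧ bCond n α ∧ yCond n α)
  (∈-arraysFrom⁺ (Tournament⇒Shape τ))
  (Equivalence.from T-∧ (proj₁ rb , Equivalence.from T-∧ (proj₂ rb , Sorted⇒yCond τ s)))
  where
  rb = Equivalence.to (T-∧ {rCond n α}) (Diagonal⇒inYbrg n α (Tournament⇒Diagonal τ))

unique-Ybrgy : ∀ n → Unique (Ybrgy n)
unique-Ybrgy n = Unique.filter⁺ _ (unique-arraysFrom 1 n)

-- The leading i of a row is minimal, so sorting the row keeps it in front and sorts exactly the
-- tail that `Step` compares with the next row.
sort-min : ∀ {i a} → All (i ≤_) a → sort (i ∷ a) ≡ i ∷ sort a
sort-min {i} {a} i≤ = Sorted-unique (sort-Sorted (i ∷ a))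
  (All-resp-↭ (↭-sym (sort-↭ a)) i≤ ∷ sort-Sorted a) (↭⇒≋ (insert-↭ i (sort a)))

sort-Tournament : ∀ {i k α} → Tournament i k α → Tournament i k (map sort α)
sort-Tournament [] = []
sort-Tournament {i} {α = (i ∷ a) ∷ α} (layer p τ) =
  subst (λ r → Tournament i _ (r ∷ map sort α)) (≡.sym (sort-min (Step-All p (row≥ τ))))
    (layer (subst (Pointwise Step (sort a)) (≡.sym (ix-map sort [] ≡.refl α 0)) (sort-Step p))
           (sort-Tournament τ))

Tournament-ext : ∀ {i k α β} → Tournament i k α → Tournament i k β →
                 (∀ t → t < k → ix [] α t ≡ ix [] β t) → α ≡ β
Tournament-ext []          []          h = ≡.refl
Tournament-ext (layer _ τ) (layer _ σ) h =
  cong₂ _∷_ (h 0 (s≤s z≤n)) (Tournament-ext τ σ (λ t t<k → h (suc t) (s≤s t<k)))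

sort-∈-Ybrgy : ∀ {n α} → Tournament 1 n α → map sort α ∈ Ybrgy n
sort-∈-Ybrgy {α = α} τ = ∈-Ybrgy⁺ (sort-Tournament τ) (λ t _ →
  subst Sorted (≡.sym (ix-map sort [] ≡.refl α t)) (sort-Sorted (ix [] α t)))

sort-Shuffle : ∀ n α → Shuffle n (map sort α) α
sort-Shuffle n α t _ v rewrite ix-map sort [] ≡.refl α t = ↭⇒≋ (sort-↭ (ix [] α t)) v

-- With `sort-∈-Ybrgy` and `sort-Shuffle` this splits Y_n({b,r,g}) into classes of row shuffles,
-- each represented by its sorted member.
Shuffle-unique : ∀ {n α α′} → α ∈ Ybrgy n → Tournament 1 n α′ → Shuffle n α α′ → α ≡ map sort α′
Shuffle-unique {n} {α} {α′} α∈ τ′ sh = let τ , s = ∈-Ybrgy⁻ α∈ in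
  Tournament-ext τ (sort-Tournament τ′) λ t t<n →
    ≡.trans (Sorted-unique (s t t<n) (sort-Sorted (ix [] α′ t))
              (λ v → ≡.trans (sh t t<n v) (≡.sym (↭⇒≋ (sort-↭ (ix [] α′ t)) v))))
            (≡.sym (ix-map sort [] ≡.refl α′ t))

-- Y_n({b,r,g}) generated row by row, from the last row upwards

-- The value 0 has no lower choice. Sums over choices are therefore evaluated under the hypothesis
-- that all entries of b are positive, which `row≥` supplies.
stepOf : ℕ → List ℕ
stepOf zero    = 0 ∷ []
stepOf (suc b) = suc b ∷ b ∷ []

-- The tail is chosen before the head, so that for a fixed tail a sum over the choices splits off
-- the two terms of the head.
steps : List ℕ → List (List ℕ)
steps []       = [] ∷ []
steps (b ∷ bs) = concatMap (λ as → map (_∷ as) (stepOf b)) (steps bs)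

tournaments : ℕ → ℕ → List Array
tournaments i zero    = [] ∷ []
tournaments i (suc k) =
  concatMap (λ α → map (λ a → (i ∷ a) ∷ α) (steps (ix [] α 0))) (tournaments (suc i) k)

∈-stepOf⁺ : ∀ {a b} → Step a b → a ∈ stepOf b
∈-stepOf⁺ {b = zero}  (z≤n , _)      = here ≡.refl
∈-stepOf⁺ {b = suc b} (a≤b , s≤s b≤a) with m≤n⇒m<n∨m≡n b≤a
... | inj₁ b<a    = here (≤-antisym a≤b b<a)
... | inj₂ ≡.refl = there (here ≡.refl)

∈-stepOf⁻ : ∀ {a} b → a ∈ stepOf b → Step a b
∈-stepOf⁻ zero    (here ≡.refl)         = z≤n , z≤n
∈-stepOf⁻ (suc b) (here ≡.refl)         = ≤-refl , n≤1+n (suc b)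
∈-stepOf⁻ (suc b) (there (here ≡.refl)) = n≤1+n b , ≤-refl

∈-steps⁺ : ∀ {a b} → Pointwise Step a b → a ∈ steps b
∈-steps⁺ []      = here ≡.refl
∈-steps⁺ (s ∷ p) = ∈-concatMap-map⁺ {g = λ as a → a ∷ as} (∈-steps⁺ p) (∈-stepOf⁺ s)

∈-steps⁻ : ∀ {a} b → a ∈ steps b → Pointwise Step a b
∈-steps⁻ []      (here ≡.refl) = []
∈-steps⁻ (b ∷ bs) a∈ with ∈-concatMap-map⁻ {g = λ as a → a ∷ as} (steps bs) a∈
... | as , a , as∈ , a∈ , ≡.refl = ∈-stepOf⁻ b a∈ ∷ ∈-steps⁻ bs as∈

∈-tournaments⁺ : ∀ {i k α} → Tournament i k α → α ∈ tournaments i k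
∈-tournaments⁺ []          = here ≡.refl
∈-tournaments⁺ (layer p τ) =
  ∈-concatMap-map⁺ {g = λ α a → (_ ∷ a) ∷ α} (∈-tournaments⁺ τ) (∈-steps⁺ p)

∈-tournaments⁻ : ∀ {i} k {α} → α ∈ tournaments i k → Tournament i k α
∈-tournaments⁻ zero (here ≡.refl) = []
∈-tournaments⁻ {i} (suc k) α∈
  with ∈-concatMap-map⁻ {g = λ α a → (i ∷ a) ∷ α} (tournaments (suc i) k) α∈
... | α , a , α∈ , a∈ , ≡.refl = layer (∈-steps⁻ (ix [] α 0) a∈) (∈-tournaments⁻ k α∈)

unique-stepOf : ∀ b → Unique (stepOf b)
unique-stepOf zero    = [] ∷ []
unique-stepOf (suc b) = (1+n≢n ∷ []) ∷ [] ∷ []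

unique-steps : ∀ b → Unique (steps b)
unique-steps []       = [] ∷ []
unique-steps (b ∷ bs) =
  unique-concatMap-map (λ { ≡.refl → ≡.refl , ≡.refl }) (unique-steps bs) (λ _ → unique-stepOf b)

unique-tournaments : ∀ i k → Unique (tournaments i k)
unique-tournaments i zero    = [] ∷ []
unique-tournaments i (suc k) =
  unique-concatMap-map (λ { ≡.refl → ≡.refl , ≡.refl }) (unique-tournaments (suc i) k)
    (λ α → unique-steps (ix [] α 0))

-- Both lists are free of duplicates and have the same members, hence agree as bags.
Ybrg-↭-tournaments : ∀ n → filterᵇ (inYbrg n) (gArrays n) ↭ tournaments 1 n
Ybrg-↭-tournaments n = ∼bag⇒↭ (unique∧set⇒bag (Unique.filter⁺ _ (unique-arraysFrom 1 n))
  (unique-tournaments 1 n) (mk⇔ to from))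
  where
  to : ∀ {α} → α ∈ filterᵇ (inYbrg n) (gArrays n) → α ∈ tournaments 1 n
  to {α} α∈ with ∈-filter⁻ (T? ∘ inYbrg n) {xs = gArrays n} α∈
  ... | α∈g , rb = ∈-tournaments⁺ (Diagonal⇒Tournament (∈-arraysFrom⁻ n α∈g) (inYbrg⇒Diagonal n α rb))
  from : ∀ {α} → α ∈ tournaments 1 n → α ∈ filterᵇ (inYbrg n) (gArrays n)
  from {α} α∈ = let τ = ∈-tournaments⁻ n α∈ in
    ∈-filter⁺ (T? ∘ inYbrg n) (∈-arraysFrom⁺ (Tournament⇒Shape τ))
      (Diagonal⇒inYbrg n α (Tournament⇒Diagonal τ))

Tournament-drop : ∀ {i k α} → Tournament i k α → ∀ t → Tournament (i + t) (k ∸ t) (drop t α)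
Tournament-drop {i} τ zero rewrite +-identityʳ i = τ
Tournament-drop [] (suc t) = []
Tournament-drop {i} (layer p τ) (suc t) rewrite +-suc i t = Tournament-drop τ t

ix-drop : {A : Set} (d : A) (xs : List A) → ∀ t u → ix d (drop t xs) u ≡ ix d xs (t + u)
ix-drop d xs       zero    u = ≡.refl
ix-drop d []       (suc t) u = ≡.refl
ix-drop d (x ∷ xs) (suc t) u = ix-drop d xs t u

tailRow : Array → ℕ → List ℕ
tailRow α t = drop 1 (ix [] α t)

row-∷ : ∀ {i k α} → Tournament i k α → ∀ t → t < k → ix [] α t ≡ (i + t) ∷ tailRow α t
row-∷ {i} (layer p τ) zero    _         = cong (_∷ _) (≡.sym (+-identityʳ i))
row-∷ {i} (layer p τ) (suc t) (s≤s t<k) rewrite +-suc i t = row-∷ τ t t<k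

row-Step : ∀ {i k α} → Tournament i k α → ∀ t → Pointwise Step (tailRow α t) (ix [] α (suc t))
row-Step []          t       = []
row-Step (layer p τ) zero    = p
row-Step (layer p τ) (suc t) = row-Step τ t

-- Beyond the last row both arrays return the default `[]`, so the row under the last one needs no
-- separate case.
≋-total : ∀ {n i α α′} → Tournament i n α → Tournament i n α′ → Shuffle n α α′ →
          ∀ t → ix [] α t ≋ ix [] α′ t
≋-total []          []           s t       v = ≡.refl
≋-total (layer _ _) (layer _ _)  s zero      = s 0 (s≤s z≤n)
≋-total (layer _ τ) (layer _ τ′) s (suc t)   = ≋-total τ τ′ (λ u u< → s (suc u) (s≤s u<)) t

≋-cancel : ∀ x {r s} → x ∷ r ≋ x ∷ s → r ≋ s
≋-cancel x {r} {s} eq v = +-cancelˡ-≡ (if v ≡ᵇ x then 1 else 0) _ _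
  (≡.trans (≡.sym (count-∷ v x r)) (≡.trans (eq v) (count-∷ v x s)))

≋-prep : ∀ x {r s} → r ≋ s → x ∷ r ≋ x ∷ s
≋-prep x {r} {s} eq v =
  ≡.trans (count-∷ v x r) (≡.trans (cong (_ +_) (eq v)) (≡.sym (count-∷ v x s)))

tailRow-≋ : ∀ {n i α α′} → Tournament i n α → Tournament i n α′ → Shuffle n α α′ →
            ∀ t → tailRow α t ≋ tailRow α′ t
tailRow-≋ []          []           s t v = ≡.refl
tailRow-≋ (layer {i = i} _ _) (layer _ _)  s zero    = ≋-cancel i (s 0 (s≤s z≤n))
tailRow-≋ (layer _ τ) (layer _ τ′) s (suc t) = tailRow-≋ τ τ′ (λ u u< → s (suc u) (s≤s u<)) t

-- Equalities with the southwest diagonal neighbour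

zipCount : (ℕ → ℕ → Bool) → List ℕ → List ℕ → ℕ
zipCount q (a ∷ as) (b ∷ bs) = (if q a b then 1 else 0) + zipCount q as bs
zipCount q _        _        = 0

length-filter-map : {A B : Set} (p : B → Bool) (f : A → B) (xs : List A) →
                    length (filterᵇ p (map f xs)) ≡ length (filterᵇ (p ∘ f) xs)
length-filter-map p f []       = ≡.refl
length-filter-map p f (x ∷ xs) with p (f x)
... | true  = cong suc (length-filter-map p f xs)
... | false = length-filter-map p f xs

length-filter-∷ : {A : Set} (p : A → Bool) (x : A) (xs : List A) →
                  length (filterᵇ p (x ∷ xs)) ≡ (if p x then 1 else 0) + length (filterᵇ p xs)
length-filter-∷ p x xs with p x
... | true  = ≡.refl
... | false = ≡.refl

length-filter-upTo : ∀ (q : ℕ → ℕ → Bool) {a b m} → length a ≡ m → length b ≡ m →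
  length (filterᵇ (λ j → q (ix 0 a j) (ix 0 b j)) (upTo m)) ≡ zipCount q a b
length-filter-upTo q {[]}    {[]}    {zero}  _  _  = ≡.refl
length-filter-upTo q {x ∷ a} {y ∷ b} {suc m} la lb = begin
  length (filterᵇ p (upTo (suc m)))
    ≡⟨ length-filter-∷ p 0 _ ⟩
  δ + length (filterᵇ p (applyUpTo suc m))
    ≡⟨ cong (λ xs → δ + length (filterᵇ p xs)) (map-upTo suc m) ⟨
  δ + length (filterᵇ p (map suc (upTo m)))
    ≡⟨ cong (δ +_) (length-filter-map p suc (upTo m)) ⟩
  δ + length (filterᵇ (p ∘ suc) (upTo m))
    ≡⟨ cong (δ +_) (length-filter-upTo q {a} {b} (suc-injective la) (suc-injective lb)) ⟩
  δ + zipCount q a b ∎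
  where
  open ≡-Reasoning
  p : ℕ → Bool
  p j = q (ix 0 (x ∷ a) j) (ix 0 (y ∷ b) j)
  δ : ℕ
  δ = if q x y then 1 else 0

filter-cong : {A : Set} {p q : A → Bool} → (∀ x → p x ≡ q x) → ∀ xs → filterᵇ p xs ≡ filterᵇ q xs
filter-cong h [] = ≡.refl
filter-cong {p = p} {q} h (x ∷ xs) with p x | q x | h x
... | true  | .true  | ≡.refl = cong (x ∷_) (filter-cong h xs)
... | false | .false | ≡.refl = filter-cong h xs

-- The test q is left open to cover both E_i, where it is equality, and E_{i,k}, where it also fixes
-- the value.
diagonal-count : ∀ (q : ℕ → ℕ → Bool) {n i α} → Tournament i n α → ∀ t → t < n →
  length (filterᵇ (λ j → q (at α (suc t) j) (at α (suc (suc t)) (j ∸ 1))) (range 1 (n ∸ suc t)))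
  ≡ zipCount q (tailRow α t) (ix [] α (suc t))
diagonal-count q {n} {i} {α} τ t t<n = begin
  length (filterᵇ p (range 1 (n ∸ suc t)))
    ≡⟨ length-filter-map p suc (upTo (n ∸ suc t)) ⟩
  length (filterᵇ (p ∘ suc) (upTo (n ∸ suc t)))
    ≡⟨ cong length (filter-cong (λ j → cong (λ z → q z (ix 0 (ix [] α (suc t)) j))
         (≡.sym (ix-drop 0 (ix [] α t) 1 j))) (upTo (n ∸ suc t))) ⟩
  length (filterᵇ (λ j → q (ix 0 (tailRow α t) j) (ix 0 (ix [] α (suc t)) j)) (upTo (n ∸ suc t)))
    ≡⟨ length-filter-upTo q {tailRow α t} {ix [] α (suc t)} (≡.trans (Pointwise-length (row-Step τ t)) len) len ⟩
  zipCount q (tailRow α t) (ix [] α (suc t)) ∎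
  where
  open ≡-Reasoning
  p : ℕ → Bool
  p j = q (at α (suc t) j) (at α (suc (suc t)) (j ∸ 1))
  len : length (ix [] α (suc t)) ≡ n ∸ suc t
  len = length-row τ (suc t)

≡ᵇ-refl : ∀ n → (n ≡ᵇ n) ≡ true
≡ᵇ-refl n = T⇒≡ (≡⇒≡ᵇ n n ≡.refl)

n≡ᵇ1+n : ∀ n → (n ≡ᵇ suc n) ≡ false
n≡ᵇ1+n n = ¬T⇒≡ (λ h → 1+n≢n (≡.sym (≡ᵇ⇒≡ n (suc n) h)))

≡ᵇ-sym : ∀ m n → (m ≡ᵇ n) ≡ (n ≡ᵇ m)
≡ᵇ-sym zero    zero    = ≡.refl
≡ᵇ-sym zero    (suc n) = ≡.refl
≡ᵇ-sym (suc m) zero    = ≡.refl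
≡ᵇ-sym (suc m) (suc n) = ≡ᵇ-sym m n

data StepView (a : ℕ) : ℕ → Set where
  stay : StepView a a
  move : StepView a (suc a)

stepView : ∀ {a b} → Step a b → StepView a b
stepView (a≤b , b≤a) with m≤n⇒m<n∨m≡n a≤b
... | inj₂ ≡.refl = stay
... | inj₁ a<b with ≤-antisym b≤a a<b
... | ≡.refl = move

shift-suc : ∀ x s l → x + s + suc l ≡ suc x + (s + l)
shift-suc = solve-∀

-- For every single pair, b + [a = b] = a + 1, whether the step is 0 or 1. Summed up, this expresses
-- the number of equalities by sums and a length, which depend only on contents.
sum+zipCount : ∀ {a b} → Pointwise Step a b → sum b + zipCount _≡ᵇ_ a b ≡ sum a + length a
sum+zipCount [] = ≡.refl
sum+zipCount {x ∷ a} {y ∷ b} (s ∷ p) with stepView s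
... | stay rewrite ≡ᵇ-refl x = begin
  x + sum b + suc (zipCount _≡ᵇ_ a b)    ≡⟨ shift-suc x (sum b) _ ⟩
  suc x + (sum b + zipCount _≡ᵇ_ a b)    ≡⟨ cong (suc x +_) (sum+zipCount p) ⟩
  suc x + (sum a + length a)             ≡⟨ shift-suc x (sum a) _ ⟨
  x + sum a + suc (length a)             ∎
  where open ≡-Reasoning
... | move rewrite n≡ᵇ1+n x = begin
  suc x + sum b + zipCount _≡ᵇ_ a b      ≡⟨ +-assoc (suc x) (sum b) _ ⟩
  suc x + (sum b + zipCount _≡ᵇ_ a b)    ≡⟨ cong (suc x +_) (sum+zipCount p) ⟩
  suc x + (sum a + length a)             ≡⟨ shift-suc x (sum a) _ ⟨
  x + sum a + suc (length a)             ∎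
  where open ≡-Reasoning

zipCount-≋ : ∀ {a b a′ b′} → Pointwise Step a b → Pointwise Step a′ b′ → a ≋ a′ → b ≋ b′ →
             zipCount _≡ᵇ_ a b ≡ zipCount _≡ᵇ_ a′ b′
zipCount-≋ {a} {b} {a′} {b′} p p′ a≋ b≋ = +-cancelˡ-≡ (sum b) _ _ (begin
  sum b + zipCount _≡ᵇ_ a b      ≡⟨ sum+zipCount p ⟩
  sum a + length a               ≡⟨ cong₂ _+_ (sum-↭ (≋⇒↭ a a′ a≋)) (↭-length (≋⇒↭ a a′ a≋)) ⟩
  sum a′ + length a′             ≡⟨ sum+zipCount p′ ⟨
  sum b′ + zipCount _≡ᵇ_ a′ b′   ≡⟨ cong (_+ _) (sum-↭ (≋⇒↭ b b′ b≋)) ⟨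
  sum b + zipCount _≡ᵇ_ a′ b′    ∎)
  where open ≡-Reasoning

Ei-Shuffle : ∀ {n i α α′} → Tournament i n α → Tournament i n α′ → Shuffle n α α′ →
             ∀ t → t < n → Ei n α (suc t) ≡ Ei n α′ (suc t)
Ei-Shuffle τ τ′ s t t<n = ≡.trans (diagonal-count _≡ᵇ_ τ t t<n) (≡.trans
  (zipCount-≋ (row-Step τ t) (row-Step τ′ t) (tailRow-≋ τ τ′ s t) (≋-total τ τ′ s (suc t)))
  (≡.sym (diagonal-count _≡ᵇ_ τ′ t t<n)))

-- For the tail of row i and row i + 1 this is E_{i,v}.
stays : ℕ → List ℕ → List ℕ → ℕ
stays v = zipCount (λ a b → (a ≡ᵇ b) ∧ (a ≡ᵇ v))

stays-stay : ∀ v x a b → stays v (x ∷ a) (x ∷ b) ≡ (if v ≡ᵇ x then 1 else 0) + stays v a b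
stays-stay v x a b rewrite ≡ᵇ-refl x | ≡ᵇ-sym x v = ≡.refl

stays-move : ∀ v x a b → stays v (x ∷ a) (suc x ∷ b) ≡ stays v a b
stays-move v x a b rewrite n≡ᵇ1+n x = ≡.refl

-- A move ends at a positive value, so every 0 of b is a copy. This starts the induction of
-- `≋⇒stays`.
stays-zero : ∀ {a b} → Pointwise Step a b → count 0 b ≡ stays 0 a b
stays-zero [] = ≡.refl
stays-zero {x ∷ a} {_ ∷ b} (s ∷ p) with stepView s
... | stay = ≡.trans (count-∷ 0 x b) (≡.trans (cong (_ +_) (stays-zero p)) (≡.sym (stays-stay 0 x a b)))
... | move = ≡.trans (count-∷ 0 (suc x) b) (≡.trans (stays-zero p) (≡.sym (stays-move 0 x a b)))

-- An entry v + 1 of b comes from a v + 1 of a that stays or from a v of a that moves.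
stays-suc : ∀ v {a b} → Pointwise Step a b →
            count (suc v) b + stays v a b ≡ stays (suc v) a b + count v a
stays-suc v [] = ≡.refl
stays-suc v {x ∷ a} {_ ∷ b} (s ∷ p) with stepView s
... | stay rewrite count-∷ (suc v) x b | count-∷ v x a | stays-stay v x a b | stays-stay (suc v) x a b =
  ≡.trans (interchange δ′ (count (suc v) b) δ (stays v a b))
    (≡.trans (cong (δ′ + δ +_) (stays-suc v p)) (interchange δ′ δ (stays (suc v) a b) (count v a)))
  where
  δ δ′ : ℕ
  δ  = if v ≡ᵇ x then 1 else 0
  δ′ = if suc v ≡ᵇ x then 1 else 0
  interchange : ∀ p q r s → (p + q) + (r + s) ≡ (p + r) + (q + s)
  interchange = solve-∀
... | move rewrite count-∷ (suc v) (suc x) b | count-∷ v x a | stays-move v x a b | stays-move (suc v) x a b =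
  ≡.trans (+-assoc δ (count (suc v) b) (stays v a b))
    (≡.trans (cong (δ +_) (stays-suc v p)) (lemma δ (stays (suc v) a b) (count v a)))
  where
  δ : ℕ
  δ = if v ≡ᵇ x then 1 else 0
  lemma : ∀ p q r → p + (q + r) ≡ q + (p + r)
  lemma = solve-∀

-- Induction on v: given `stays v` and the counts, `stays-suc` has `stays (suc v)` as its only
-- unknown.
≋⇒stays : ∀ {a b a′ b′} → Pointwise Step a b → Pointwise Step a′ b′ → b ≋ b′ → a ≋ a′ →
          ∀ v → stays v a b ≡ stays v a′ b′
≋⇒stays p p′ b≋ a≋ zero = ≡.trans (≡.sym (stays-zero p)) (≡.trans (b≋ 0) (stays-zero p′))
≋⇒stays {a} {b} {a′} {b′} p p′ b≋ a≋ (suc v) = +-cancelʳ-≡ (count v a) _ _ (begin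
  stays (suc v) a b + count v a      ≡⟨ stays-suc v p ⟨
  count (suc v) b + stays v a b      ≡⟨ cong₂ _+_ (b≋ (suc v)) (≋⇒stays p p′ b≋ a≋ v) ⟩
  count (suc v) b′ + stays v a′ b′   ≡⟨ stays-suc v p′ ⟩
  stays (suc v) a′ b′ + count v a′   ≡⟨ cong (stays (suc v) a′ b′ +_) (a≋ v) ⟨
  stays (suc v) a′ b′ + count v a    ∎)
  where open ≡-Reasoning

-- The balance `stays-suc` again, now with `count v a` as the unknown.
stays⇒≋ : ∀ {a b a′ b′} → Pointwise Step a b → Pointwise Step a′ b′ → b ≋ b′ →
          (∀ v → stays v a b ≡ stays v a′ b′) → a ≋ a′
stays⇒≋ {a} {b} {a′} {b′} p p′ b≋ s v = +-cancelˡ-≡ (stays (suc v) a b) _ _ (begin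
  stays (suc v) a b + count v a      ≡⟨ stays-suc v p ⟨
  count (suc v) b + stays v a b      ≡⟨ cong₂ _+_ (b≋ (suc v)) (s v) ⟩
  count (suc v) b′ + stays v a′ b′   ≡⟨ stays-suc v p′ ⟩
  stays (suc v) a′ b′ + count v a′   ≡⟨ cong (_+ count v a′) (s (suc v)) ⟨
  stays (suc v) a b + count v a′     ∎)
  where open ≡-Reasoning

stays≤count : ∀ v a b → stays v a b ≤ count v b
stays≤count v []      b  = z≤n
stays≤count v (x ∷ a) [] = z≤n
stays≤count v (x ∷ a) (y ∷ b) rewrite count-∷ v y b = +-mono-≤ δ≤ (stays≤count v a b)
  where
  δ≤ : (if (x ≡ᵇ y) ∧ (x ≡ᵇ v) then 1 else 0) ≤ (if v ≡ᵇ y then 1 else 0)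
  δ≤ with x ≡ᵇ y in xy | x ≡ᵇ v in xv
  ... | false | _     = z≤n
  ... | true  | false = z≤n
  ... | true  | true
    with ≡.refl ← ≡ᵇ⇒≡ x y (subst T (≡.sym xy) _) | ≡.refl ← ≡ᵇ⇒≡ x v (subst T (≡.sym xv) _)
    rewrite ≡ᵇ-refl x = ≤-refl

stays≡0 : ∀ {v} a b → count v b ≡ 0 → stays v a b ≡ 0
stays≡0 {v} a b eq = n≤0⇒n≡0 (subst (stays v a b ≤_) eq (stays≤count v a b))

-- Counting row shuffles

module ℕΣ = Fold +-0-commutativeMonoid
module ℕΠ = Fold *-1-commutativeMonoid

⟦_⟧ : Bool → ℕ
⟦ b ⟧ = if b then 1 else 0

nC0≡1 : ∀ n → n C 0 ≡ 1
nC0≡1 n = ≡.trans (nCk≡nC[n∸k] {0} {n} z≤n) (nCn≡1 n)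

Π-zero : ∀ n (f : ℕ → ℕ) {v} → v < n → f v ≡ 0 → ℕΠ.⨁ (upTo n) f ≡ 0
Π-zero (suc n) f {zero}  _         eq = ≡.trans (ℕΠ.⨁-upTo-suc n f) (cong (_* ℕΠ.⨁ (upTo n) (f ∘ suc)) eq)
Π-zero (suc n) f {suc v} (s≤s v<n) eq = ≡.trans (ℕΠ.⨁-upTo-suc n f)
  (≡.trans (cong (f 0 *_) (Π-zero n (f ∘ suc) v<n eq)) (*-zeroʳ (f 0)))

-- A product is additive in each single factor. It carries Pascal's rule at one value c over to the
-- whole product of binomials.
Π-linear : ∀ n (f g h : ℕ → ℕ) {c} → c < n →
  (∀ v → v ≢ c → f v ≡ g v × f v ≡ h v) → f c ≡ g c + h c →
  ℕΠ.⨁ (upTo n) f ≡ ℕΠ.⨁ (upTo n) g + ℕΠ.⨁ (upTo n) h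
Π-linear (suc n) f g h {zero} _ off at-c = begin
  ℕΠ.⨁ (upTo (suc n)) f                 ≡⟨ ℕΠ.⨁-upTo-suc n f ⟩
  f 0 * ℕΠ.⨁ (upTo n) (f ∘ suc)         ≡⟨ cong (_* ℕΠ.⨁ (upTo n) (f ∘ suc)) at-c ⟩
  (g 0 + h 0) * ℕΠ.⨁ (upTo n) (f ∘ suc) ≡⟨ *-distribʳ-+ _ (g 0) (h 0) ⟩
  g 0 * ℕΠ.⨁ (upTo n) (f ∘ suc) + h 0 * ℕΠ.⨁ (upTo n) (f ∘ suc)
    ≡⟨ cong₂ (λ x y → g 0 * x + h 0 * y)
         (ℕΠ.⨁-cong (upTo n) (λ {v} _ → proj₁ (off (suc v) λ ())))
         (ℕΠ.⨁-cong (upTo n) (λ {v} _ → proj₂ (off (suc v) λ ()))) ⟩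
  g 0 * ℕΠ.⨁ (upTo n) (g ∘ suc) + h 0 * ℕΠ.⨁ (upTo n) (h ∘ suc)
    ≡⟨ cong₂ _+_ (ℕΠ.⨁-upTo-suc n g) (ℕΠ.⨁-upTo-suc n h) ⟨
  ℕΠ.⨁ (upTo (suc n)) g + ℕΠ.⨁ (upTo (suc n)) h ∎
  where open ≡-Reasoning
Π-linear (suc n) f g h {suc c} (s≤s c<n) off at-c = begin
  ℕΠ.⨁ (upTo (suc n)) f                 ≡⟨ ℕΠ.⨁-upTo-suc n f ⟩
  f 0 * ℕΠ.⨁ (upTo n) (f ∘ suc)
    ≡⟨ cong (f 0 *_) (Π-linear n (f ∘ suc) (g ∘ suc) (h ∘ suc) c<n
         (λ v v≢c → off (suc v) (v≢c ∘ suc-injective)) at-c) ⟩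
  f 0 * (ℕΠ.⨁ (upTo n) (g ∘ suc) + ℕΠ.⨁ (upTo n) (h ∘ suc)) ≡⟨ *-distribˡ-+ (f 0) _ _ ⟩
  f 0 * ℕΠ.⨁ (upTo n) (g ∘ suc) + f 0 * ℕΠ.⨁ (upTo n) (h ∘ suc)
    ≡⟨ cong₂ _+_ (cong (_* ℕΠ.⨁ (upTo n) (g ∘ suc)) (proj₁ (off 0 λ ())))
                 (cong (_* ℕΠ.⨁ (upTo n) (h ∘ suc)) (proj₂ (off 0 λ ()))) ⟩
  g 0 * ℕΠ.⨁ (upTo n) (g ∘ suc) + h 0 * ℕΠ.⨁ (upTo n) (h ∘ suc)
    ≡⟨ cong₂ _+_ (ℕΠ.⨁-upTo-suc n g) (ℕΠ.⨁-upTo-suc n h) ⟨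
  ℕΠ.⨁ (upTo (suc n)) g + ℕΠ.⨁ (upTo (suc n)) h ∎
  where open ≡-Reasoning

-- Each head of b is either copied, which uses up one of the copies demanded by e, or lowered, which
-- leaves e alone; Pascal's rule adds the two numbers. The predicate p enters only through its
-- equivalence with the demand e, so that the recursion can replace it by p after a fixed head. K
-- makes the product finite.
count-steps : ∀ K (e : ℕ → ℕ) (p : List ℕ → Bool) b → All (1 ≤_) b → All (_< K) b →
  (∀ v → K ≤ v → e v ≡ 0) →
  (∀ a → Pointwise Step a b → T (p a) ⇔ (∀ v → stays v a b ≡ e v)) →
  ℕΣ.⨁ (steps b) (λ a → ⟦ p a ⟧) ≡ ℕΠ.⨁ (upTo K) (λ v → count v b C e v)
count-steps K e p [] _ _ e≥K h with p [] in eq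
... | true = ≡.sym (≡.trans
  (ℕΠ.⨁-cong (upTo K) (λ {v} _ → cong (0 C_) (≡.sym (Equivalence.to (h [] []) (subst T (≡.sym eq) _) v))))
  (ℕΠ.⨁-ε (upTo K)))
-- The empty list copies nothing, so p fails only if e is nonzero somewhere, necessarily below K;
-- there the factor 0 C e v vanishes.
... | false with anyUpTo? (λ v → ¬? (e v ≟ 0)) K
... | yes (v , v<K , ev≢0) = ≡.sym (Π-zero K (λ v → 0 C e v) v<K (k>n⇒nCk≡0 (n≢0⇒n>0 ev≢0)))
... | no  all0 = contradiction (subst T eq (Equivalence.from (h [] []) e≡0)) (λ ())
  where
  e≡0 : ∀ v → 0 ≡ e v
  e≡0 v with v <? K
  ... | yes v<K = ≡.sym (decidable-stable (e v ≟ 0) (λ ev≢0 → all0 (v , v<K , ev≢0)))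
  ... | no  v≮K = ≡.sym (e≥K v (≮⇒≥ v≮K))
count-steps K e p (suc c ∷ b) (_ ∷ b>0) (c<K ∷ b<K) e≥K h = begin
  ℕΣ.⨁ (steps (suc c ∷ b)) (λ a → ⟦ p a ⟧)
    ≡⟨ ℕΣ.⨁-concatMap (λ as → map (_∷ as) (stepOf (suc c))) (steps b) ⟩
  ℕΣ.⨁ (steps b) (λ as → ⟦ p (suc c ∷ as) ⟧ + (⟦ p (c ∷ as) ⟧ + 0))
    ≡⟨ ℕΣ.⨁-cong (steps b) (λ {as} _ → cong (⟦ p (suc c ∷ as) ⟧ +_) (+-identityʳ _)) ⟩
  ℕΣ.⨁ (steps b) (λ as → ⟦ p (suc c ∷ as) ⟧ + ⟦ p (c ∷ as) ⟧)
    ≡⟨ ℕΣ.⨁-∙ (steps b) ⟨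
  ℕΣ.⨁ (steps b) (λ as → ⟦ p (suc c ∷ as) ⟧) + ℕΣ.⨁ (steps b) (λ as → ⟦ p (c ∷ as) ⟧)
    ≡⟨ cong (ℕΣ.⨁ (steps b) (λ as → ⟦ p (suc c ∷ as) ⟧) +_) moving ⟩
  ℕΣ.⨁ (steps b) (λ as → ⟦ p (suc c ∷ as) ⟧) + ℕΠ.⨁ (upTo K) (λ v → count v b C e v)
    ≡⟨ pascal (e (suc c)) ≡.refl ⟩
  ℕΠ.⨁ (upTo K) (λ v → count v (suc c ∷ b) C e v) ∎
  where
  open ≡-Reasoning
  moving : ℕΣ.⨁ (steps b) (λ as → ⟦ p (c ∷ as) ⟧) ≡ ℕΠ.⨁ (upTo K) (λ v → count v b C e v)
  moving = count-steps K e (p ∘ (c ∷_)) b b>0 b<K e≥K λ a st →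
    mk⇔ (λ pa v → ≡.trans (≡.sym (stays-move v c a b))
                    (Equivalence.to (h (c ∷ a) ((n≤1+n c , ≤-refl) ∷ st)) pa v))
        (λ eq → Equivalence.from (h (c ∷ a) ((n≤1+n c , ≤-refl) ∷ st))
                  (λ v → ≡.trans (stays-move v c a b) (eq v)))

  off : ∀ v → v ≢ suc c → (v ≡ᵇ suc c) ≡ false
  off v v≢ = ¬T⇒≡ (v≢ ∘ ≡ᵇ⇒≡ v (suc c))

  count-off : ∀ v → v ≢ suc c → count v (suc c ∷ b) ≡ count v b
  count-off v v≢ rewrite off v v≢ = ≡.refl

  count-on : count (suc c) (suc c ∷ b) ≡ suc (count (suc c) b)
  count-on rewrite ≡ᵇ-refl c = ≡.refl

  keep : ∀ {a} → Pointwise Step a b → Pointwise Step (suc c ∷ a) (suc c ∷ b)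
  keep st = (≤-refl , n≤1+n _) ∷ st

  -- If no copy of suc c is demanded, no list may keep the head, and its binomial is 1 with or
  -- without it. Otherwise keeping the head leaves m of the demanded copies. Passing m with an
  -- equation keeps e itself intact in the case split.
  pascal : ∀ m → e (suc c) ≡ m →
    ℕΣ.⨁ (steps b) (λ as → ⟦ p (suc c ∷ as) ⟧) + ℕΠ.⨁ (upTo K) (λ v → count v b C e v) ≡
    ℕΠ.⨁ (upTo K) (λ v → count v (suc c ∷ b) C e v)
  pascal zero ec = cong₂ _+_ {u = ℕΠ.⨁ (upTo K) (λ v → count v b C e v)}
    (≡.trans (ℕΣ.⨁-cong (steps b) none) (ℕΣ.⨁-ε (steps b)))
    (ℕΠ.⨁-cong (upTo K) (λ {v} _ → same v))
    where
    none : ∀ {a} → a ∈ steps b → ⟦ p (suc c ∷ a) ⟧ ≡ 0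
    none {a} a∈ with p (suc c ∷ a) in eq
    ... | false = ≡.refl
    ... | true  = contradiction
      (≡.trans (≡.sym on) (≡.trans (Equivalence.to (h (suc c ∷ a) (keep (∈-steps⁻ b a∈))) (subst T (≡.sym eq) _) (suc c)) ec))
      λ ()
      where
      on : stays (suc c) (suc c ∷ a) (suc c ∷ b) ≡ suc (stays (suc c) a b)
      on rewrite ≡ᵇ-refl c = ≡.refl
    same : ∀ v → count v b C e v ≡ count v (suc c ∷ b) C e v
    same v with v ≟ suc c
    ... | no  v≢     = cong (_C e v) (≡.sym (count-off v v≢))
    ... | yes ≡.refl = ≡.trans (≡.trans (cong (count v b C_) ec) (nC0≡1 (count v b)))
                         (≡.sym (≡.trans (cong (count v (suc c ∷ b) C_) ec) (nC0≡1 (count v (suc c ∷ b)))))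
  pascal (suc m) ec = ≡.trans
    (cong (_+ ℕΠ.⨁ (upTo K) (λ v → count v b C e v)) staying)
    (≡.sym (Π-linear K _ (λ v → count v b C e′ v) _ c<K
      (λ v v≢ → ≡.trans (cong (_C e v) (count-off v v≢)) (cong (count v b C_) (≡.sym (e′-off v v≢))) ,
                cong (_C e v) (count-off v v≢))
      (≡.trans (cong₂ _C_ count-on ec) (≡.trans (≡.sym (nCk+nC[k+1]≡[n+1]C[k+1] (count (suc c) b) m))
        (cong₂ (λ x y → (count (suc c) b C x) + (count (suc c) b C y)) (≡.sym e′-on) (≡.sym ec))))))
    where
    -- The demand that remains once the head suc c has been copied.
    e′ : ℕ → ℕ
    e′ v = if v ≡ᵇ suc c then m else e v
    e′-on : e′ (suc c) ≡ m
    e′-on rewrite ≡ᵇ-refl c = ≡.refl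
    e′-off : ∀ v → v ≢ suc c → e′ v ≡ e v
    e′-off v v≢ rewrite off v v≢ = ≡.refl
    e-split : ∀ v → e v ≡ ⟦ v ≡ᵇ suc c ⟧ + e′ v
    e-split v with v ≟ suc c
    ... | yes ≡.refl rewrite ≡ᵇ-refl c = ec
    ... | no  v≢     rewrite off v v≢ = ≡.refl
    e′≥K : ∀ v → K ≤ v → e′ v ≡ 0
    e′≥K v K≤v = ≡.trans (e′-off v (λ { ≡.refl → ≤⇒≯ K≤v c<K })) (e≥K v K≤v)
    staying : ℕΣ.⨁ (steps b) (λ as → ⟦ p (suc c ∷ as) ⟧) ≡ ℕΠ.⨁ (upTo K) (λ v → count v b C e′ v)
    staying = count-steps K e′ (p ∘ (suc c ∷_)) b b>0 b<K e′≥K λ a st → mk⇔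
      (λ pa v → +-cancelˡ-≡ ⟦ v ≡ᵇ suc c ⟧ _ _ (≡.trans (≡.sym (stays-stay v (suc c) a b))
                  (≡.trans (Equivalence.to (h (suc c ∷ a) (keep st)) pa v) (e-split v))))
      (λ eq → Equivalence.from (h (suc c ∷ a) (keep st)) (λ v → ≡.trans (stays-stay v (suc c) a b)
                  (≡.trans (cong (⟦ v ≡ᵇ suc c ⟧ +_) (eq v)) (≡.sym (e-split v)))))

-- The sum i + k is the same for all rows of an array, so one bound K serves the whole induction
-- over rows.
row< : ∀ {i k α} → Tournament i k α → All (_< i + k) (ix [] α 0)
row< [] = []
row< {i} {suc k} (layer {α = α} p τ) =
  m<m+n i (s≤s z≤n) ∷ go p (subst (λ K → All (_< K) (ix [] α 0)) (≡.sym (+-suc i k)) (row< τ))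
  where
  go : ∀ {K a b} → Pointwise Step a b → All (_< K) b → All (_< K) a
  go []              []         = []
  go ((a≤b , _) ∷ p) (b<K ∷ bs) = ≤-<-trans a≤b b<K ∷ go p bs

rowwiseReordering-∷ : ∀ k r r′ α α′ → rowwiseReordering (suc k) (r ∷ α) (r′ ∷ α′) ≡
                      isReordering r r′ ∧ rowwiseReordering k α α′
rowwiseReordering-∷ k r r′ α α′ = cong (λ xs → isReordering r r′ ∧ and xs) (begin
  map q (map suc (applyUpTo suc k))  ≡⟨ cong (map q ∘ map suc) (map-upTo suc k) ⟨
  map q (map suc (map suc (upTo k)))           ≡⟨ map-∘ (map suc (upTo k)) ⟨
  map (q ∘ suc) (map suc (upTo k))             ≡⟨ map-∘ (upTo k) ⟨
  map (q ∘ suc ∘ suc) (upTo k)                 ≡⟨ map-∘ (upTo k) ⟩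
  map q′ (map suc (upTo k))                    ∎)
  where
  open ≡-Reasoning
  q q′ : ℕ → Bool
  q  i = isReordering (row (r ∷ α) i) (row (r′ ∷ α′) i)
  q′ i = isReordering (row α i) (row α′ i)

-- The range of v is the same for every row, to keep the induction uniform; `choices-row` cuts it
-- down to the range in the theorem.
choices : ℕ → Array → ℕ → ℕ
choices K α t = ℕΠ.⨁ (upTo K) (λ v → count v (ix [] α (suc t)) C stays v (tailRow α t) (ix [] α (suc t)))

-- Whichever reordering β′ of the lower rows is fixed, the top row has the same number of
-- arrangements over it, because the first rows of β and β′ have equal counts. So the numbers
-- multiply.
count-reorderings : ∀ K i k {α} → i + k ≤ K → Tournament i k α →
  ℕΣ.⨁ (tournaments i k) (λ α′ → ⟦ rowwiseReordering k α α′ ⟧) ≡ ℕΠ.⨁ (upTo k) (choices K α)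
count-reorderings K i zero    _    []            = ≡.refl
count-reorderings K i (suc k) {(i ∷ a) ∷ β} i+k≤K (layer p τ) = begin
  ℕΣ.⨁ (tournaments i (suc k)) (λ α′ → ⟦ rowwiseReordering (suc k) α α′ ⟧)
    ≡⟨ ℕΣ.⨁-concatMap (λ β′ → map (λ a′ → (i ∷ a′) ∷ β′) (steps (ix [] β′ 0))) (tournaments (suc i) k) ⟩
  ℕΣ.⨁ (tournaments (suc i) k) (λ β′ → ℕΣ.⨁ (map (λ a′ → (i ∷ a′) ∷ β′) (steps (ix [] β′ 0)))
    (λ α′ → ⟦ rowwiseReordering (suc k) α α′ ⟧))
    ≡⟨ ℕΣ.⨁-cong (tournaments (suc i) k) (λ {β′} β′∈ → inner β′ (∈-tournaments⁻ k β′∈)) ⟩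
  ℕΣ.⨁ (tournaments (suc i) k) (λ β′ → ⟦ rowwiseReordering k β β′ ⟧ * choices K α 0)
    ≡⟨ Σ-*ʳ (tournaments (suc i) k) ⟩
  ℕΣ.⨁ (tournaments (suc i) k) (λ β′ → ⟦ rowwiseReordering k β β′ ⟧) * choices K α 0
    ≡⟨ cong (_* choices K α 0) (count-reorderings K (suc i) k i+k≤K′ τ) ⟩
  ℕΠ.⨁ (upTo k) (choices K β) * choices K α 0
    ≡⟨ *-comm (ℕΠ.⨁ (upTo k) (choices K β)) (choices K α 0) ⟩
  choices K α 0 * ℕΠ.⨁ (upTo k) (choices K β)
    ≡⟨ ℕΠ.⨁-upTo-suc k (choices K α) ⟨
  ℕΠ.⨁ (upTo (suc k)) (choices K α) ∎
  where
  open ≡-Reasoning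
  α : Array
  α = (i ∷ a) ∷ β
  b : List ℕ
  b = ix [] β 0
  i+k≤K′ : suc i + k ≤ K
  i+k≤K′ = subst (_≤ K) (+-suc i k) i+k≤K
  Σ-*ʳ : ∀ {A : Set} {f : A → ℕ} {c} (xs : List A) → ℕΣ.⨁ xs (λ x → f x * c) ≡ ℕΣ.⨁ xs f * c
  Σ-*ʳ []       = ≡.refl
  Σ-*ʳ {f = f} {c} (x ∷ xs) = ≡.trans (cong (f x * c +_) (Σ-*ʳ xs)) (≡.sym (*-distribʳ-+ c (f x) _))

  stays≥K : ∀ v → K ≤ v → stays v a b ≡ 0
  stays≥K v K≤v = stays≡0 a b (count≡0 {v} {b} λ w∈ w≡v →
    <⇒≢ (<-≤-trans (All.lookup (row< τ) w∈) (≤-trans i+k≤K′ K≤v)) w≡v)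

  reorder-row : ∀ β′ → Tournament (suc i) k β′ → Shuffle k β β′ →
    ℕΣ.⨁ (steps (ix [] β′ 0)) (λ a′ → ⟦ isReordering (i ∷ a) (i ∷ a′) ⟧) ≡ choices K α 0
  reorder-row β′ τ′ sh = ≡.trans
    (count-steps K (λ v → stays v a b) (λ a′ → isReordering (i ∷ a) (i ∷ a′)) (ix [] β′ 0)
      (All.map (≤-trans (s≤s z≤n)) (row≥ τ′)) (All.map (λ lt → <-≤-trans lt i+k≤K′) (row< τ′)) stays≥K
      -- Over rows with equal contents, having the contents of a and having the copies of a are the
      -- same demand; `count-steps` needs the second form.
      λ a′ p′ → mk⇔
        (λ h v → ≋⇒stays p′ p (≡.sym ∘ b≋) (≡.sym ∘ ≋-cancel i {a} {a′} (isReordering⇒≋ (i ∷ a) (i ∷ a′) h)) v)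
        (λ h → ≋⇒isReordering (i ∷ a) (i ∷ a′) (≋-prep i {a} {a′} (stays⇒≋ p p′ b≋ (≡.sym ∘ h)))))
    (ℕΠ.⨁-cong (upTo K) (λ {v} _ → cong (_C stays v a b) (≡.sym (b≋ v))))
    where
    b≋ : b ≋ ix [] β′ 0
    b≋ = ≋-total τ τ′ sh 0

  inner : ∀ β′ → Tournament (suc i) k β′ →
    ℕΣ.⨁ (map (λ a′ → (i ∷ a′) ∷ β′) (steps (ix [] β′ 0))) (λ α′ → ⟦ rowwiseReordering (suc k) α α′ ⟧)
    ≡ ⟦ rowwiseReordering k β β′ ⟧ * choices K α 0
  inner β′ τ′ = ≡.trans (ℕΣ.⨁-map (λ a′ → (i ∷ a′) ∷ β′) (steps (ix [] β′ 0))) (≡.trans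
    (ℕΣ.⨁-cong (steps (ix [] β′ 0)) (λ {a′} _ → cong ⟦_⟧ (rowwiseReordering-∷ k (i ∷ a) (i ∷ a′) β β′)))
    split)
    where
    split : ℕΣ.⨁ (steps (ix [] β′ 0)) (λ a′ → ⟦ isReordering (i ∷ a) (i ∷ a′) ∧ rowwiseReordering k β β′ ⟧)
            ≡ ⟦ rowwiseReordering k β β′ ⟧ * choices K α 0
    split with rowwiseReordering k β β′ in eq
    ... | false = ≡.trans (ℕΣ.⨁-cong (steps (ix [] β′ 0)) (λ {a′} _ → cong ⟦_⟧ (∧-zeroʳ (isReordering (i ∷ a) (i ∷ a′)))))
                    (ℕΣ.⨁-ε (steps (ix [] β′ 0)))
    ... | true  = ≡.trans (ℕΣ.⨁-cong (steps (ix [] β′ 0)) (λ {a′} _ → cong ⟦_⟧ (∧-identityʳ (isReordering (i ∷ a) (i ∷ a′)))))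
                    (≡.trans (reorder-row β′ τ′ (reordering⇒Shuffle k β β′ (subst T (≡.sym eq) _)))
                      (≡.sym (+-identityʳ (choices K α 0))))

module _ (M : CommutativeMonoid 0ℓ 0ℓ) where
  open CommutativeMonoid M using (Carrier; _≈_; ε; setoid; reflexive)
  open Fold M
  open import Relation.Binary.Reasoning.Setoid setoid

  -- Stated for any commutative monoid, since it is applied to the weighted sum in the semiring and
  -- to the number of shuffles in ℕ.
  ⨁-rowShuffles : ∀ n α (f : Array → Carrier) → ⨁ (rowShuffles n α) f ≈
    ⨁ (tournaments 1 n) (λ α′ → if rowwiseReordering n α α′ then f α′ else ε)
  ⨁-rowShuffles n α f = begin
    ⨁ (rowShuffles n α) f
      ≈⟨ ⨁-filter (λ α′ → inYbrg n α′ ∧ rowwiseReordering n α α′) (gArrays n) ⟩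
    ⨁ (gArrays n) (λ α′ → if inYbrg n α′ ∧ rowwiseReordering n α α′ then f α′ else ε)
      ≈⟨ ⨁-cong (gArrays n) (λ {α′} _ → reflexive (if-∧ (inYbrg n α′))) ⟩
    ⨁ (gArrays n) (λ α′ → if inYbrg n α′ then (if rowwiseReordering n α α′ then f α′ else ε) else ε)
      ≈⟨ ⨁-filter (inYbrg n) (gArrays n) ⟨
    ⨁ (filterᵇ (inYbrg n) (gArrays n)) (λ α′ → if rowwiseReordering n α α′ then f α′ else ε)
      ≈⟨ ⨁-↭ (Ybrg-↭-tournaments n) ⟩
    ⨁ (tournaments 1 n) (λ α′ → if rowwiseReordering n α α′ then f α′ else ε) ∎
    where
    if-∧ : ∀ a {b} {x y : Carrier} → (if a ∧ b then x else y) ≡ (if a then (if b then x else y) else y)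
    if-∧ true  = ≡.refl
    if-∧ false = ≡.refl

length≡Σ1 : {A : Set} (xs : List A) → length xs ≡ ℕΣ.⨁ xs (const 1)
length≡Σ1 []       = ≡.refl
length≡Σ1 (x ∷ xs) = cong suc (length≡Σ1 xs)

-- When v bounds b, an entry v of a forces v in the same place of b.
count-max : ∀ {v a b} → Pointwise Step a b → All (_≤ v) b → count v a ≤ count v b
count-max [] [] = z≤n
count-max {v} {x ∷ a} {y ∷ b} ((x≤y , _) ∷ p) (y≤v ∷ bs)
  rewrite count-∷ v x a | count-∷ v y b = +-mono-≤ δ≤ (count-max p bs)
  where
  δ≤ : (if v ≡ᵇ x then 1 else 0) ≤ (if v ≡ᵇ y then 1 else 0)
  δ≤ with v ≡ᵇ x in eq
  ... | false = z≤n
  ... | true with ≡ᵇ⇒≡ v x (subst T (≡.sym eq) _)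
  ... | ≡.refl with ≤-antisym x≤y y≤v
  ... | ≡.refl rewrite ≡ᵇ-refl x = ≤-refl

-- The value i + k is the sole entry of the last row, and by `count-max` its count cannot grow on
-- the way up.
count-top : ∀ {i k α} → Tournament i (suc k) α → count (i + k) (ix [] α 0) ≤ 1
count-top {i} {zero}  (layer [] []) = length-filter (T? ∘ (i + 0 ≡ᵇ_)) (i ∷ [])
count-top {i} {suc k} (layer {a = a} {α = α} p τ)
  rewrite count-∷ (i + suc k) i a
        | ¬T⇒≡ {i + suc k ≡ᵇ i} (λ h → m+1+n≢m i (≡ᵇ⇒≡ (i + suc k) i h))
        | +-suc i k
  = ≤-trans (count-max p (All.map (λ {w} lt → s≤s⁻¹ (subst (w <_) (cong suc (+-suc i k)) lt)) (row< τ)))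
            (count-top τ)

C≡1 : ∀ {m k} → k ≤ m → m ≤ 1 → m C k ≡ 1
C≡1 z≤n       z≤n       = ≡.refl
C≡1 z≤n       (s≤s z≤n) = ≡.refl
C≡1 (s≤s z≤n) (s≤s z≤n) = ≡.refl

-- The values v ≤ t and v = m + 1 contribute trivial factors: (0 choose 0), and (c choose e) with e ≤ c ≤ 1.
choices-row : ∀ m {α} → Tournament 1 (suc m) α → ∀ t → t < m →
  choices (suc (suc m)) α t ≡ ℕΠ.⨁ (range (suc t) m) (λ k → Cik α (suc (suc t)) k C Eik (suc m) α (suc t) k)
choices-row m {α} τ t t<m = begin
  ℕΠ.⨁ (upTo (suc (suc m))) f
    ≡⟨ ℕΠ.⨁-upTo-∷ʳ (suc m) f ⟩
  ℕΠ.⨁ (upTo (suc m)) f * f (suc m)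
    ≡⟨ cong (ℕΠ.⨁ (upTo (suc m)) f *_) top ⟩
  ℕΠ.⨁ (upTo (suc m)) f * 1
    ≡⟨ *-identityʳ _ ⟩
  ℕΠ.⨁ (upTo (suc m)) f
    ≡⟨ cong (λ z → ℕΠ.⨁ (upTo (suc z)) f) (m+[n∸m]≡n (<⇒≤ t<m)) ⟨
  ℕΠ.⨁ (upTo (suc t + (m ∸ t))) f
    ≡⟨ ℕΠ.⨁-upTo-+ (suc t) (m ∸ t) f ⟩
  ℕΠ.⨁ (upTo (suc t)) f * ℕΠ.⨁ (upTo (m ∸ t)) (f ∘ (suc t +_))
    ≡⟨ cong (_* ℕΠ.⨁ (upTo (m ∸ t)) (f ∘ (suc t +_)))
         (≡.trans (ℕΠ.⨁-cong (upTo (suc t)) (λ v∈ → low (∈-upTo⁻ v∈))) (ℕΠ.⨁-ε (upTo (suc t)))) ⟩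
  1 * ℕΠ.⨁ (upTo (m ∸ t)) (f ∘ (suc t +_))
    ≡⟨ *-identityˡ _ ⟩
  ℕΠ.⨁ (upTo (m ∸ t)) (f ∘ (suc t +_))
    ≡⟨ ℕΠ.⨁-map {f = f} (suc t +_) (upTo (m ∸ t)) ⟨
  ℕΠ.⨁ (range (suc t) m) f
    ≡⟨ ℕΠ.⨁-cong (range (suc t) m) (λ {k} _ → cong (count k b C_)
         (≡.sym (diagonal-count (λ a b → (a ≡ᵇ b) ∧ (a ≡ᵇ k)) τ t (m<n⇒m<1+n t<m)))) ⟩
  ℕΠ.⨁ (range (suc t) m) (λ k → Cik α (suc (suc t)) k C Eik (suc m) α (suc t) k) ∎
  where
  open ≡-Reasoning
  a b : List ℕ
  a = tailRow α t
  b = ix [] α (suc t)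
  f : ℕ → ℕ
  f v = count v b C stays v a b
  τ′ : Tournament (suc (suc t)) (m ∸ t) (drop (suc t) α)
  τ′ = Tournament-drop τ (suc t)
  first : ix [] (drop (suc t) α) 0 ≡ b
  first = ≡.trans (ix-drop [] α (suc t) 0) (cong (ix [] α) (+-identityʳ (suc t)))
  low : ∀ {v} → v < suc t → f v ≡ 1
  low {v} v≤t = ≡.trans (cong₂ _C_ none (stays≡0 a b none)) ≡.refl
    where
    none : count v b ≡ 0
    none = count≡0 {v} {b} (λ w∈ w≡v → <⇒≢
      (<-≤-trans (m<n⇒m<1+n v≤t) (All.lookup (subst (All (suc (suc t) ≤_)) first (row≥ τ′)) w∈)) (≡.sym w≡v))
  top : f (suc m) ≡ 1
  top = C≡1 (stays≤count (suc m) a b)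
    (subst₂ (λ v r → count v r ≤ 1) (cong suc m≡) first
      (count-top (subst (λ k → Tournament (suc (suc t)) k (drop (suc t) α)) k≡ τ′)))
    where
    k≡ : m ∸ t ≡ suc (m ∸ suc t)
    k≡ = +-∸-assoc 1 t<m
    m≡ : suc t + (m ∸ suc t) ≡ m
    m≡ = m+[n∸m]≡n t<m

length-rowShuffles : ∀ m {α} → Tournament 1 (suc m) α → length (rowShuffles (suc m) α) ≡
  ℕΠ.⨁ (range 1 m) (λ i → ℕΠ.⨁ (range i m) (λ k → Cik α (suc i) k C Eik (suc m) α i k))
length-rowShuffles m {α} τ = begin
  length (rowShuffles (suc m) α)
    ≡⟨ length≡Σ1 (rowShuffles (suc m) α) ⟩
  ℕΣ.⨁ (rowShuffles (suc m) α) (const 1)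
    ≡⟨ ⨁-rowShuffles +-0-commutativeMonoid (suc m) α (const 1) ⟩
  ℕΣ.⨁ (tournaments 1 (suc m)) (λ α′ → ⟦ rowwiseReordering (suc m) α α′ ⟧)
    ≡⟨ count-reorderings (suc (suc m)) 1 (suc m) ≤-refl τ ⟩
  ℕΠ.⨁ (upTo (suc m)) (choices (suc (suc m)) α)
    ≡⟨ ℕΠ.⨁-upTo-∷ʳ m (choices (suc (suc m)) α) ⟩
  ℕΠ.⨁ (upTo m) (choices (suc (suc m)) α) * choices (suc (suc m)) α m
    ≡⟨ cong₂ _*_ (ℕΠ.⨁-cong (upTo m) (λ t∈ → choices-row m τ _ (∈-upTo⁻ t∈))) last ⟩
  ℕΠ.⨁ (upTo m) (λ t → ℕΠ.⨁ (range (suc t) m) (λ k → Cik α (suc (suc t)) k C Eik (suc m) α (suc t) k)) * 1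
    ≡⟨ *-identityʳ _ ⟩
  ℕΠ.⨁ (upTo m) (λ t → ℕΠ.⨁ (range (suc t) m) (λ k → Cik α (suc (suc t)) k C Eik (suc m) α (suc t) k))
    ≡⟨ ℕΠ.⨁-map {f = λ i → ℕΠ.⨁ (range i m) (λ k → Cik α (suc i) k C Eik (suc m) α i k)} suc (upTo m) ⟨
  ℕΠ.⨁ (range 1 m) (λ i → ℕΠ.⨁ (range i m) (λ k → Cik α (suc i) k C Eik (suc m) α i k)) ∎
  where
  open ≡-Reasoning
  empty : ∀ {xs : List ℕ} → length xs ≡ 0 → xs ≡ []
  empty {[]} _ = ≡.refl
  -- Index m is row n, under which lies the default `[]`; this is why the product in the theorem
  -- stops at n - 1.
  last : choices (suc (suc m)) α m ≡ 1
  last = ≡.trans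
    (cong (λ r → ℕΠ.⨁ (upTo (suc (suc m))) (λ v → count v r C stays v (tailRow α m) r))
      (empty (≡.trans (length-row τ (suc m)) (n∸n≡0 m))))
    (≡.trans (ℕΠ.⨁-cong (upTo (suc (suc m))) (λ {v} _ → cong (0 C_) (stays≡0 {v} (tailRow α m) [] ≡.refl)))
             (ℕΠ.⨁-ε (upTo (suc (suc m)))))

-- Weighted sums over the arrays in a commutative semiring

module _ (R : CommutativeSemiring 0ℓ 0ℓ) where
  open CommutativeSemiring R hiding (zero)
    renaming ( Carrier to ∣R∣; _+_ to _⊕_; _*_ to _⊛_; refl to ≈-refl; sym to ≈-sym; trans to ≈-trans
             ; +-identityʳ to ⊕-identityʳ; +-comm to ⊕-comm; *-comm to ⊛-comm; +-congˡ to ⊕-congˡ; +-cong to ⊕-cong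
             ; *-identityˡ to ⊛-identityˡ; *-identityʳ to ⊛-identityʳ; *-assoc to ⊛-assoc
             ; *-cong to ⊛-cong; *-congˡ to ⊛-congˡ; *-congʳ to ⊛-congʳ)
  open import Algebra.Definitions.RawSemiring rawSemiring using (_^_) renaming (_×_ to _·_)
  open import Algebra.Properties.Semiring.Mult semiring using (×1-homo-*)
  open import Algebra.Properties.Monoid.Mult *-monoid using () renaming (×-homo-+ to ^-homo-+)
  open import Relation.Binary.Reasoning.Setoid setoid
  module RΣ = Fold +-commutativeMonoid
  module RΠ = Fold *-commutativeMonoid

  private variable
    f : A → ∣R∣

  *-distribˡ-Σ : ∀ c (xs : List A) → c ⊛ RΣ.⨁ xs f ≈ RΣ.⨁ xs (λ x → c ⊛ f x)
  *-distribˡ-Σ c []       = zeroʳ c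
  *-distribˡ-Σ c (x ∷ xs) = ≈-trans (distribˡ c _ _) (⊕-congˡ (*-distribˡ-Σ c xs))

  *-distribʳ-Σ : ∀ c (xs : List A) → RΣ.⨁ xs f ⊛ c ≈ RΣ.⨁ xs (λ x → f x ⊛ c)
  *-distribʳ-Σ c []       = zeroˡ c
  *-distribʳ-Σ c (x ∷ xs) = ≈-trans (distribʳ c _ _) (⊕-congˡ (*-distribʳ-Σ c xs))

  ^-sum : ∀ c (e : A → ℕ) xs → c ^ sum (map e xs) ≈ RΠ.⨁ xs (λ x → c ^ e x)
  ^-sum c e []       = ≈-refl
  ^-sum c e (x ∷ xs) = ≈-trans (^-homo-+ c (e x) _) (⊛-congˡ (^-sum c e xs))

  1^n≈1 : ∀ n → 1# ^ n ≈ 1#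
  1^n≈1 zero    = ≈-refl
  1^n≈1 (suc n) = ≈-trans (⊛-identityˡ _) (1^n≈1 n)

  ·1-Π : (e : A → ℕ) (xs : List A) → ℕΠ.⨁ xs e · 1# ≈ RΠ.⨁ xs (λ x → e x · 1#)
  ·1-Π e []       = ⊕-identityʳ 1#
  ·1-Π e (x ∷ xs) = ≈-trans (×1-homo-* (e x) _) (⊛-congˡ (·1-Π e xs))

  -- A positive entry of b has two choices above it, exactly one of them equal to it. The sum
  -- therefore factors over columns, and the values of b drop out.
  Σ-steps : ∀ z l (y : ℕ → ∣R∣) b → All (1 ≤_) b →
    RΣ.⨁ (steps b) (λ a → RΠ.⨁ (upTo (length b)) (λ j → if ix 0 a j ≡ᵇ ix 0 b j then l ⊛ y j else z)) ≈
    RΠ.⨁ (upTo (length b)) (λ j → z ⊕ l ⊛ y j)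
  Σ-steps z l y []          []        = ⊕-identityʳ 1#
  Σ-steps z l y (suc c ∷ b) (_ ∷ b>0) = begin
    RΣ.⨁ (steps (suc c ∷ b)) (F y (suc c ∷ b))
      ≈⟨ RΣ.⨁-concatMap (λ as → map (_∷ as) (stepOf (suc c))) (steps b) ⟩
    RΣ.⨁ (steps b) (λ as → F y (suc c ∷ b) (suc c ∷ as) ⊕ (F y (suc c ∷ b) (c ∷ as) ⊕ 0#))
      ≈⟨ RΣ.⨁-cong (steps b) (λ {as} _ → two as) ⟩
    RΣ.⨁ (steps b) (λ as → (z ⊕ l ⊛ y 0) ⊛ F (y ∘ suc) b as)
      ≈⟨ *-distribˡ-Σ (z ⊕ l ⊛ y 0) (steps b) ⟨
    (z ⊕ l ⊛ y 0) ⊛ RΣ.⨁ (steps b) (F (y ∘ suc) b)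
      ≈⟨ ⊛-congˡ (Σ-steps z l (y ∘ suc) b b>0) ⟩
    (z ⊕ l ⊛ y 0) ⊛ RΠ.⨁ (upTo (length b)) (λ j → z ⊕ l ⊛ y (suc j))
      ≡⟨ RΠ.⨁-upTo-suc (length b) (λ j → z ⊕ l ⊛ y j) ⟨
    RΠ.⨁ (upTo (length (suc c ∷ b))) (λ j → z ⊕ l ⊛ y j) ∎
    where
    F : (ℕ → ∣R∣) → List ℕ → List ℕ → ∣R∣
    F y b a = RΠ.⨁ (upTo (length b)) (λ j → if ix 0 a j ≡ᵇ ix 0 b j then l ⊛ y j else z)
    F-∷ : ∀ x as → F y (suc c ∷ b) (x ∷ as) ≡ (if x ≡ᵇ suc c then l ⊛ y 0 else z) ⊛ F (y ∘ suc) b as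
    F-∷ x as = RΠ.⨁-upTo-suc (length b)
      (λ j → if ix 0 (x ∷ as) j ≡ᵇ ix 0 (suc c ∷ b) j then l ⊛ y j else z)
    two : ∀ as → F y (suc c ∷ b) (suc c ∷ as) ⊕ (F y (suc c ∷ b) (c ∷ as) ⊕ 0#) ≈
                 (z ⊕ l ⊛ y 0) ⊛ F (y ∘ suc) b as
    two as = begin
      F y (suc c ∷ b) (suc c ∷ as) ⊕ (F y (suc c ∷ b) (c ∷ as) ⊕ 0#)
        ≈⟨ ⊕-congˡ (⊕-identityʳ _) ⟩
      F y (suc c ∷ b) (suc c ∷ as) ⊕ F y (suc c ∷ b) (c ∷ as)
        ≡⟨ cong₂ _⊕_ (F-∷ (suc c) as) (F-∷ c as) ⟩
      (if c ≡ᵇ c then l ⊛ y 0 else z) ⊛ F (y ∘ suc) b as ⊕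
      (if c ≡ᵇ suc c then l ⊛ y 0 else z) ⊛ F (y ∘ suc) b as
        ≡⟨ cong₂ (λ p q → (if p then l ⊛ y 0 else z) ⊛ F (y ∘ suc) b as ⊕
                          (if q then l ⊛ y 0 else z) ⊛ F (y ∘ suc) b as) (≡ᵇ-refl c) (n≡ᵇ1+n c) ⟩
      (l ⊛ y 0) ⊛ F (y ∘ suc) b as ⊕ z ⊛ F (y ∘ suc) b as
        ≈⟨ ⊕-comm _ _ ⟩
      z ⊛ F (y ∘ suc) b as ⊕ (l ⊛ y 0) ⊛ F (y ∘ suc) b as
        ≈⟨ distribʳ _ _ _ ⟨
      (z ⊕ l ⊛ y 0) ⊛ F (y ∘ suc) b as ∎

  -- By hypothesis the sum over row t is W t for every row b below, so rows can be summed out one at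
  -- a time from the top. The leading entry c is arbitrary because it changes from row to row.
  Σ-tournaments : ∀ i k (F : ℕ → List ℕ → List ℕ → ∣R∣) (W : ℕ → ∣R∣) →
    (∀ t c b → length b ≡ k ∸ suc t → All (1 ≤_) b → RΣ.⨁ (steps b) (λ a → F t (c ∷ a) b) ≈ W t) →
    RΣ.⨁ (tournaments i k) (λ α → RΠ.⨁ (upTo k) (λ t → F t (ix [] α t) (ix [] α (suc t)))) ≈ RΠ.⨁ (upTo k) W
  Σ-tournaments i zero    F W h = ⊕-identityʳ 1#
  Σ-tournaments i (suc k) F W h = begin
    RΣ.⨁ (tournaments i (suc k)) G
      ≈⟨ RΣ.⨁-concatMap (λ β → map (λ a → (i ∷ a) ∷ β) (steps (ix [] β 0))) (tournaments (suc i) k) ⟩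
    RΣ.⨁ (tournaments (suc i) k) (λ β → RΣ.⨁ (map (λ a → (i ∷ a) ∷ β) (steps (ix [] β 0))) G)
      ≈⟨ RΣ.⨁-cong (tournaments (suc i) k) (λ {β} β∈ → first β (∈-tournaments⁻ k β∈)) ⟩
    RΣ.⨁ (tournaments (suc i) k) (λ β → W 0 ⊛ G′ β)
      ≈⟨ *-distribˡ-Σ (W 0) (tournaments (suc i) k) ⟨
    W 0 ⊛ RΣ.⨁ (tournaments (suc i) k) G′
      ≈⟨ ⊛-congˡ (Σ-tournaments (suc i) k (F ∘ suc) (W ∘ suc) (h ∘ suc)) ⟩
    W 0 ⊛ RΠ.⨁ (upTo k) (W ∘ suc)
      ≡⟨ RΠ.⨁-upTo-suc k W ⟨
    RΠ.⨁ (upTo (suc k)) W ∎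
    where
    G G′ : Array → ∣R∣
    G  α = RΠ.⨁ (upTo (suc k)) (λ t → F t (ix [] α t) (ix [] α (suc t)))
    G′ β = RΠ.⨁ (upTo k) (λ t → F (suc t) (ix [] β t) (ix [] β (suc t)))
    first : ∀ β → Tournament (suc i) k β →
            RΣ.⨁ (map (λ a → (i ∷ a) ∷ β) (steps (ix [] β 0))) G ≈ W 0 ⊛ G′ β
    first β τ = begin
      RΣ.⨁ (map (λ a → (i ∷ a) ∷ β) (steps (ix [] β 0))) G
        ≡⟨ RΣ.⨁-map (λ a → (i ∷ a) ∷ β) (steps (ix [] β 0)) ⟩
      RΣ.⨁ (steps (ix [] β 0)) (λ a → G ((i ∷ a) ∷ β))
        ≈⟨ RΣ.⨁-cong (steps (ix [] β 0)) (λ {a} _ → reflexive (RΠ.⨁-upTo-suc k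
             (λ t → F t (ix [] ((i ∷ a) ∷ β) t) (ix [] ((i ∷ a) ∷ β) (suc t))))) ⟩
      RΣ.⨁ (steps (ix [] β 0)) (λ a → F 0 (i ∷ a) (ix [] β 0) ⊛ G′ β)
        ≈⟨ *-distribʳ-Σ (G′ β) (steps (ix [] β 0)) ⟨
      RΣ.⨁ (steps (ix [] β 0)) (λ a → F 0 (i ∷ a) (ix [] β 0)) ⊛ G′ β
        ≈⟨ ⊛-congʳ (h 0 i (ix [] β 0) (length-row τ 0) (All.map (≤-trans (s≤s z≤n)) (row≥ τ))) ⟩
      W 0 ⊛ G′ β ∎

  -- The two sides of the identities

  module _ (x : ℕ → ∣R∣) (l : ∣R∣) where

    -- Both indices count from 0: this is the weight of α_{t+1,j+1}, which lies on diagonal t + j +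
    -- 2.
    cell : ℕ → ℕ → Bool → ∣R∣
    cell t j eq = if eq then l ⊛ x (suc t + suc j) else x (suc t)

    weight : ℕ → Array → ∣R∣
    weight n α = RΠ.⨁ (upTo n) (λ t → RΠ.⨁ (upTo (n ∸ suc t)) (λ j → cell t j (diagEq α (suc t) (suc j))))

    LHS₁≈weights : ∀ n → LHS₁ R n x l ≈ RΣ.⨁ (tournaments 1 n) (weight n)
    LHS₁≈weights n = begin
      LHS₁ R n x l
        ≡⟨ RΠ.⨁-map {f = λ j → RΠ.⨁ (range 1 (j ∸ 1)) (λ i → x i ⊕ (l ⊛ x j))} suc (upTo n) ⟩
      RΠ.⨁ (upTo n) (λ j → RΠ.⨁ (range 1 j) (λ i → x i ⊕ (l ⊛ x (suc j))))
        ≈⟨ RΠ.⨁-cong (upTo n) (λ {j} _ → reflexive (RΠ.⨁-map {f = λ i → x i ⊕ (l ⊛ x (suc j))} suc (upTo j))) ⟩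
      RΠ.⨁ (upTo n) (λ j → RΠ.⨁ (upTo j) (λ i → x (suc i) ⊕ (l ⊛ x (suc j))))
        -- Grouped by the smaller index, the factors line up with the entries that have a southwest
        -- neighbour.
        ≈⟨ RΠ.⨁-triangle n (λ i j → x (suc i) ⊕ (l ⊛ x (suc j))) ⟩
      RΠ.⨁ (upTo n) (λ t → RΠ.⨁ (upTo (n ∸ suc t)) (λ j → x (suc t) ⊕ (l ⊛ x (suc (suc (t + j))))))
        ≈⟨ RΠ.⨁-cong (upTo n) (λ {t} _ → RΠ.⨁-cong (upTo (n ∸ suc t)) (λ {j} _ → reflexive
             (cong (λ k → x (suc t) ⊕ (l ⊛ x (suc k))) (≡.sym (+-suc t j))))) ⟩
      RΠ.⨁ (upTo n) (λ t → RΠ.⨁ (upTo (n ∸ suc t)) (λ j → x (suc t) ⊕ (l ⊛ x (suc t + suc j))))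
        ≈⟨ Σ-tournaments 1 n
             (λ t r s → RΠ.⨁ (upTo (n ∸ suc t)) (λ j → cell t j (ix 0 r (suc j) ≡ᵇ ix 0 s j)))
             (λ t → RΠ.⨁ (upTo (n ∸ suc t)) (λ j → x (suc t) ⊕ (l ⊛ x (suc t + suc j))))
             (λ { t c b len b>0 → subst (λ m → RΣ.⨁ (steps b) (λ a → RΠ.⨁ (upTo m) (λ j → cell t j (ix 0 a j ≡ᵇ ix 0 b j)))
                     ≈ RΠ.⨁ (upTo m) (λ j → x (suc t) ⊕ (l ⊛ x (suc t + suc j)))) len
                   (Σ-steps (x (suc t)) l (λ j → x (suc t + suc j)) b b>0) }) ⟨
      RΣ.⨁ (tournaments 1 n) (weight n) ∎

    exponents-E : ∀ n α → l ^ E n α ≈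
      RΠ.⨁ (upTo n) (λ t → RΠ.⨁ (upTo (n ∸ suc t)) (λ j → if diagEq α (suc t) (suc j) then l else 1#))
    exponents-E n α = begin
      l ^ E n α
        ≈⟨ ^-sum l (Ei n α) (range 1 n) ⟩
      RΠ.⨁ (range 1 n) (λ i → l ^ Ei n α i)
        ≡⟨ RΠ.⨁-map {f = λ i → l ^ Ei n α i} suc (upTo n) ⟩
      RΠ.⨁ (upTo n) (λ t → l ^ Ei n α (suc t))
        ≈⟨ RΠ.⨁-cong (upTo n) (λ {t} _ → ≈-trans
             (RΠ.⨁-·-filter (diagEq α (suc t)) l (range 1 (n ∸ suc t)))
             (reflexive (RΠ.⨁-map {f = λ j → if diagEq α (suc t) j then l else 1#} suc (upTo (n ∸ suc t))))) ⟩
      RΠ.⨁ (upTo n) (λ t → RΠ.⨁ (upTo (n ∸ suc t)) (λ j → if diagEq α (suc t) (suc j) then l else 1#)) ∎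

    exponents-Ei : ∀ n α → 1 ≤ n → RΠ.⨁ (range 1 (n ∸ 1)) (λ i → x i ^ ((n ∸ i) ∸ Ei n α i)) ≈
      RΠ.⨁ (upTo n) (λ t → RΠ.⨁ (upTo (n ∸ suc t)) (λ j → if diagEq α (suc t) (suc j) then 1# else x (suc t)))
    exponents-Ei (suc m) α _ = begin
      RΠ.⨁ (range 1 m) (λ i → x i ^ ((suc m ∸ i) ∸ Ei (suc m) α i))
        ≡⟨ RΠ.⨁-map {f = λ i → x i ^ ((suc m ∸ i) ∸ Ei (suc m) α i)} suc (upTo m) ⟩
      RΠ.⨁ (upTo m) f′
        ≈⟨ ⊛-identityʳ _ ⟨
      RΠ.⨁ (upTo m) f′ ⊛ 1#
        -- The product in the theorem ends at row n - 1; row n is added with exponent 0 to match the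
        -- other two products.
        ≡⟨ cong (λ e → RΠ.⨁ (upTo m) f′ ⊛ x (suc m) ^ e)
             (≡.trans (cong (_∸ Ei (suc m) α (suc m)) (n∸n≡0 m)) (0∸n≡0 (Ei (suc m) α (suc m)))) ⟨
      RΠ.⨁ (upTo m) f′ ⊛ f′ m
        ≈⟨ RΠ.⨁-upTo-∷ʳ m f′ ⟨
      RΠ.⨁ (upTo (suc m)) f′
        ≈⟨ RΠ.⨁-cong (upTo (suc m)) (λ {t} _ → row-exponent t) ⟩
      RΠ.⨁ (upTo (suc m)) (λ t → RΠ.⨁ (upTo (m ∸ t)) (λ j → if diagEq α (suc t) (suc j) then 1# else x (suc t))) ∎
      where
      f′ : ℕ → ∣R∣
      f′ t = x (suc t) ^ ((m ∸ t) ∸ Ei (suc m) α (suc t))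
      row-exponent : ∀ t → f′ t ≈ RΠ.⨁ (upTo (m ∸ t)) (λ j → if diagEq α (suc t) (suc j) then 1# else x (suc t))
      row-exponent t = begin
        x (suc t) ^ ((m ∸ t) ∸ Ei (suc m) α (suc t))
          ≡⟨ cong (λ k → x (suc t) ^ (k ∸ Ei (suc m) α (suc t)))
               (≡.trans (length-map suc (upTo (m ∸ t))) (length-upTo (m ∸ t))) ⟨
        x (suc t) ^ (length (range 1 (m ∸ t)) ∸ Ei (suc m) α (suc t))
          ≈⟨ RΠ.⨁-·-complement (diagEq α (suc t)) (x (suc t)) (range 1 (m ∸ t)) ⟩
        RΠ.⨁ (range 1 (m ∸ t)) (λ j → if diagEq α (suc t) j then 1# else x (suc t))
          ≡⟨ RΠ.⨁-map {f = λ j → if diagEq α (suc t) j then 1# else x (suc t)} suc (upTo (m ∸ t)) ⟩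
        RΠ.⨁ (upTo (m ∸ t)) (λ j → if diagEq α (suc t) (suc j) then 1# else x (suc t)) ∎

    -- Exchanging the product over d with the one over positions leaves each entry with j ≥ 1 its
    -- own diagonal d = i + j, which lies between 2 and n; column 0 contributes 1.
    exponents-Ed : ∀ n α → RΠ.⨁ (range 2 n) (λ d → x d ^ Ed n α d) ≈
      RΠ.⨁ (upTo n) (λ t → RΠ.⨁ (upTo (n ∸ suc t)) (λ j → if diagEq α (suc t) (suc j) then x (suc t + suc j) else 1#))
    exponents-Ed n α = begin
      RΠ.⨁ (range 2 n) (λ d → x d ^ Ed n α d)
        ≈⟨ RΠ.⨁-cong (range 2 n) (λ {d} _ → RΠ.⨁-·-filter _ (x d) (positions n)) ⟩
      RΠ.⨁ (range 2 n) (λ d → RΠ.⨁ (positions n) (λ p → g (proj₁ p) (proj₂ p) d))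
        ≈⟨ RΠ.⨁-swap (range 2 n) (positions n) ⟩
      RΠ.⨁ (positions n) (λ p → G (proj₁ p) (proj₂ p))
        ≈⟨ RΠ.⨁-concatMap (λ i → map (i ,_) (upTo (suc (n ∸ i)))) (range 1 n) ⟩
      RΠ.⨁ (range 1 n) (λ i → RΠ.⨁ (map (i ,_) (upTo (suc (n ∸ i)))) (λ p → G (proj₁ p) (proj₂ p)))
        ≡⟨ RΠ.⨁-map {f = λ i → RΠ.⨁ (map (i ,_) (upTo (suc (n ∸ i)))) (λ p → G (proj₁ p) (proj₂ p))} suc (upTo n) ⟩
      RΠ.⨁ (upTo n) (λ t → RΠ.⨁ (map (suc t ,_) (upTo (suc (n ∸ suc t)))) (λ p → G (proj₁ p) (proj₂ p)))
        ≈⟨ RΠ.⨁-cong (upTo n) (λ {t} t∈ → row-exponent t (∈-upTo⁻ t∈)) ⟩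
      RΠ.⨁ (upTo n) (λ t → RΠ.⨁ (upTo (n ∸ suc t)) (λ j → if diagEq α (suc t) (suc j) then x (suc t + suc j) else 1#)) ∎
      where
      g : ℕ → ℕ → ℕ → ∣R∣
      g i j d = if (1 ≤ᵇ j) ∧ ((i + j) ≡ᵇ d) ∧ diagEq α i j then x d else 1#
      G : ℕ → ℕ → ∣R∣
      G i j = RΠ.⨁ (range 2 n) (g i j)
      entry : ∀ t j → t < n → j < n ∸ suc t →
              G (suc t) (suc j) ≈ (if diagEq α (suc t) (suc j) then x (suc t + suc j) else 1#)
      entry t j t<n j< with diagEq α (suc t) (suc j)
      ... | false = ≈-trans (RΠ.⨁-cong (range 2 n) (λ {d} _ → reflexive
                      (cong (if_then x d else 1#) (∧-zeroʳ (suc t + suc j ≡ᵇ d))))) (RΠ.⨁-ε (range 2 n))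
      ... | true  = ≈-trans (RΠ.⨁-cong (range 2 n) (λ {d} _ → reflexive
                      (cong (if_then x d else 1#) (∧-identityʳ (suc t + suc j ≡ᵇ d)))))
                    (RΠ.⨁-single {f = x} (range 2 n) (unique-range 2 n)
                      (∈-range⁺ (s≤s (subst (1 ≤_) (≡.sym (+-suc t j)) (s≤s z≤n)))
                        (subst (suc t + suc j ≤_) (m+[n∸m]≡n t<n) (+-monoʳ-≤ (suc t) j<)))
                      (≡⇒≡ᵇ (suc t + suc j) _ ≡.refl)
                      (λ {d} _ h → ≡.sym (≡ᵇ⇒≡ (suc t + suc j) d h)))
      row-exponent : ∀ t → t < n →
        RΠ.⨁ (map (suc t ,_) (upTo (suc (n ∸ suc t)))) (λ p → G (proj₁ p) (proj₂ p)) ≈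
        RΠ.⨁ (upTo (n ∸ suc t)) (λ j → if diagEq α (suc t) (suc j) then x (suc t + suc j) else 1#)
      row-exponent t t<n = begin
        RΠ.⨁ (map (suc t ,_) (upTo (suc (n ∸ suc t)))) (λ p → G (proj₁ p) (proj₂ p))
          ≡⟨ RΠ.⨁-map {f = λ p → G (proj₁ p) (proj₂ p)} (suc t ,_) (upTo (suc (n ∸ suc t))) ⟩
        RΠ.⨁ (upTo (suc (n ∸ suc t))) (G (suc t))
          ≡⟨ RΠ.⨁-upTo-suc (n ∸ suc t) (G (suc t)) ⟩
        G (suc t) 0 ⊛ RΠ.⨁ (upTo (n ∸ suc t)) (G (suc t) ∘ suc)
          ≈⟨ ⊛-cong (RΠ.⨁-ε (range 2 n)) (RΠ.⨁-cong (upTo (n ∸ suc t)) (λ {j} j∈ → entry t j t<n (∈-upTo⁻ j∈))) ⟩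
        1# ⊛ RΠ.⨁ (upTo (n ∸ suc t)) (λ j → if diagEq α (suc t) (suc j) then x (suc t + suc j) else 1#)
          ≈⟨ ⊛-identityˡ _ ⟩
        RΠ.⨁ (upTo (n ∸ suc t)) (λ j → if diagEq α (suc t) (suc j) then x (suc t + suc j) else 1#) ∎

    -- Entry by entry: a copied entry takes l from the first product and x_{i+j} from the third, any
    -- other entry takes x_i from the second.
    weight-exponents : ∀ n α → 1 ≤ n →
      l ^ E n α ⊛ (RΠ.⨁ (range 1 (n ∸ 1)) (λ i → x i ^ ((n ∸ i) ∸ Ei n α i)) ⊛
                   RΠ.⨁ (range 2 n) (λ d → x d ^ Ed n α d)) ≈ weight n α
    weight-exponents n α 1≤n = begin
      l ^ E n α ⊛ (RΠ.⨁ (range 1 (n ∸ 1)) (λ i → x i ^ ((n ∸ i) ∸ Ei n α i)) ⊛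
                   RΠ.⨁ (range 2 n) (λ d → x d ^ Ed n α d))
        ≈⟨ ⊛-cong (exponents-E n α) (⊛-cong (exponents-Ei n α 1≤n) (exponents-Ed n α)) ⟩
      ΠΠ e₁ ⊛ (ΠΠ e₂ ⊛ ΠΠ e₃)
        ≈⟨ ⊛-congˡ (ΠΠ-* e₂ e₃) ⟩
      ΠΠ e₁ ⊛ ΠΠ (λ t j → e₂ t j ⊛ e₃ t j)
        ≈⟨ ΠΠ-* e₁ (λ t j → e₂ t j ⊛ e₃ t j) ⟩
      ΠΠ (λ t j → e₁ t j ⊛ (e₂ t j ⊛ e₃ t j))
        ≈⟨ RΠ.⨁-cong (upTo n) (λ {t} _ → RΠ.⨁-cong (upTo (n ∸ suc t)) (λ {j} _ → merge t j)) ⟩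
      weight n α ∎
      where
      e₁ e₂ e₃ : ℕ → ℕ → ∣R∣
      e₁ t j = if diagEq α (suc t) (suc j) then l else 1#
      e₂ t j = if diagEq α (suc t) (suc j) then 1# else x (suc t)
      e₃ t j = if diagEq α (suc t) (suc j) then x (suc t + suc j) else 1#
      ΠΠ : (ℕ → ℕ → ∣R∣) → ∣R∣
      ΠΠ e = RΠ.⨁ (upTo n) (λ t → RΠ.⨁ (upTo (n ∸ suc t)) (e t))
      ΠΠ-* : ∀ e e′ → ΠΠ e ⊛ ΠΠ e′ ≈ ΠΠ (λ t j → e t j ⊛ e′ t j)
      ΠΠ-* e e′ = ≈-trans (RΠ.⨁-∙ (upTo n)) (RΠ.⨁-cong (upTo n) (λ {t} _ → RΠ.⨁-∙ (upTo (n ∸ suc t))))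
      merge : ∀ t j → e₁ t j ⊛ (e₂ t j ⊛ e₃ t j) ≈ cell t j (diagEq α (suc t) (suc j))
      merge t j with diagEq α (suc t) (suc j)
      ... | true  = ⊛-congˡ (⊛-identityˡ _)
      ... | false = ≈-trans (⊛-identityˡ _) (⊛-identityʳ _)

    -- For α in Y_n({b,r,g,y}) and a row shuffle α′ of it, E and all E_i agree on α and α′.
    RHS₁≈weights : ∀ n → 1 ≤ n → RHS₁ R n x l ≈ RΣ.⨁ (tournaments 1 n) (weight n)
    RHS₁≈weights n 1≤n = begin
      RHS₁ R n x l
        ≈⟨ RΣ.⨁-cong (Ybrgy n) (λ {α} α∈ → per-array α (proj₁ (∈-Ybrgy⁻ α∈))) ⟩
      RΣ.⨁ (Ybrgy n) (λ α → RΣ.⨁ (tournaments 1 n) (λ α′ → if rowwiseReordering n α α′ then weight n α′ else 0#))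
        ≈⟨ RΣ.⨁-swap (Ybrgy n) (tournaments 1 n) ⟩
      RΣ.⨁ (tournaments 1 n) (λ α′ → RΣ.⨁ (Ybrgy n) (λ α → if rowwiseReordering n α α′ then weight n α′ else 0#))
        -- After the exchange, each α′ meets exactly one α, namely `map sort α′`.
        ≈⟨ RΣ.⨁-cong (tournaments 1 n) (λ {α′} α′∈ → let τ′ = ∈-tournaments⁻ n α′∈ in
             RΣ.⨁-single {f = const (weight n α′)} {p = λ α → rowwiseReordering n α α′} (Ybrgy n) (unique-Ybrgy n)
               (sort-∈-Ybrgy τ′) (Shuffle⇒reordering n (map sort α′) α′ (sort-Shuffle n α′))
               (λ {α} α∈ h → Shuffle-unique α∈ τ′ (reordering⇒Shuffle n α α′ h))) ⟩
      RΣ.⨁ (tournaments 1 n) (weight n) ∎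
      where
      X : Array → ∣R∣
      X α = RΠ.⨁ (range 1 (n ∸ 1)) (λ i → x i ^ ((n ∸ i) ∸ Ei n α i))
      D : Array → ∣R∣
      D α = RΠ.⨁ (range 2 n) (λ d → x d ^ Ed n α d)

      shuffled : ∀ α α′ → Tournament 1 n α → Tournament 1 n α′ →
        l ^ E n α ⊛ (X α ⊛ (if rowwiseReordering n α α′ then D α′ else 0#)) ≈
        (if rowwiseReordering n α α′ then weight n α′ else 0#)
      shuffled α α′ τ τ′ with rowwiseReordering n α α′ in eq
      ... | false = ≈-trans (⊛-congˡ (zeroʳ _)) (zeroʳ _)
      ... | true  = begin
        l ^ E n α ⊛ (X α ⊛ D α′)
          ≈⟨ ⊛-cong (≈-trans (^-sum l (Ei n α) (range 1 n)) (≈-trans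
               (RΠ.⨁-cong (range 1 n) (λ i∈ → reflexive (cong (l ^_) (same-Ei _ (∈-range⁻ {1} {n} i∈)))))
               (≈-sym (^-sum l (Ei n α′) (range 1 n)))))
             (⊛-congʳ (RΠ.⨁-cong (range 1 (n ∸ 1)) (λ {i} i∈ → let 1≤i , i≤n-1 = ∈-range⁻ {1} {n ∸ 1} i∈ in
               reflexive (cong (λ e → x i ^ ((n ∸ i) ∸ e)) (same-Ei i (1≤i , ≤-trans i≤n-1 (m∸n≤m n 1))))))) ⟩
        l ^ E n α′ ⊛ (X α′ ⊛ D α′)
          ≈⟨ weight-exponents n α′ 1≤n ⟩
        weight n α′ ∎
        where
        same-Ei : ∀ i → 1 ≤ i × i ≤ n → Ei n α i ≡ Ei n α′ i
        same-Ei (suc t) (_ , t<n) = Ei-Shuffle τ τ′ (reordering⇒Shuffle n α α′ (subst T (≡.sym eq) _)) t t<n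

      per-array : ∀ α → Tournament 1 n α → l ^ E n α ⊛ (X α ⊛ RΣ.⨁ (rowShuffles n α) D) ≈
        RΣ.⨁ (tournaments 1 n) (λ α′ → if rowwiseReordering n α α′ then weight n α′ else 0#)
      per-array α τ = begin
        l ^ E n α ⊛ (X α ⊛ RΣ.⨁ (rowShuffles n α) D)
          ≈⟨ ⊛-congˡ (⊛-congˡ (⨁-rowShuffles +-commutativeMonoid n α D)) ⟩
        l ^ E n α ⊛ (X α ⊛ RΣ.⨁ (tournaments 1 n) (λ α′ → if rowwiseReordering n α α′ then D α′ else 0#))
          ≈⟨ ⊛-congˡ (*-distribˡ-Σ (X α) (tournaments 1 n)) ⟩
        l ^ E n α ⊛ RΣ.⨁ (tournaments 1 n) (λ α′ → X α ⊛ (if rowwiseReordering n α α′ then D α′ else 0#))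
          ≈⟨ *-distribˡ-Σ (l ^ E n α) (tournaments 1 n) ⟩
        RΣ.⨁ (tournaments 1 n) (λ α′ → l ^ E n α ⊛ (X α ⊛ (if rowwiseReordering n α α′ then D α′ else 0#)))
          ≈⟨ RΣ.⨁-cong (tournaments 1 n) (λ {α′} α′∈ → shuffled α α′ τ (∈-tournaments⁻ n α′∈)) ⟩
        RΣ.⨁ (tournaments 1 n) (λ α′ → if rowwiseReordering n α α′ then weight n α′ else 0#) ∎

    identity₁ : ∀ n → 1 ≤ n → LHS₁ R n x l ≈ RHS₁ R n x l
    identity₁ n 1≤n = ≈-trans (LHS₁≈weights n) (≈-sym (RHS₁≈weights n 1≤n))

  LHS₂≈LHS₁ : ∀ n l → LHS₂ R n l ≈ LHS₁ R n (const 1#) l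
  LHS₂≈LHS₁ n l = ≈-sym (begin
    LHS₁ R n (const 1#) l
      ≡⟨ RΠ.⨁-map {f = λ j → RΠ.⨁ (range 1 (j ∸ 1)) (λ _ → 1# ⊕ l ⊛ 1#)} suc (upTo n) ⟩
    RΠ.⨁ (upTo n) (λ j → RΠ.⨁ (range 1 j) (λ _ → 1# ⊕ l ⊛ 1#))
      ≈⟨ RΠ.⨁-cong (upTo n) (λ {j} _ → ≈-trans
           (RΠ.⨁-cong (range 1 j) (λ _ → ⊕-congˡ (⊛-identityʳ l)))
           (≈-trans (RΠ.⨁-const c (range 1 j))
             (reflexive (cong (c ^_) (≡.trans (length-map suc (upTo j)) (length-upTo j)))))) ⟩
    RΠ.⨁ (upTo n) (λ j → c ^ j)
      ≈⟨ triangular n ⟩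
    c ^ (n C 2) ∎)
    where
    c : ∣R∣
    c = 1# ⊕ l
    triangular : ∀ n → RΠ.⨁ (upTo n) (λ j → c ^ j) ≈ c ^ (n C 2)
    triangular zero    = ≈-refl
    triangular (suc n) = begin
      RΠ.⨁ (upTo (suc n)) (λ j → c ^ j)           ≈⟨ RΠ.⨁-upTo-∷ʳ n (c ^_) ⟩
      RΠ.⨁ (upTo n) (λ j → c ^ j) ⊛ c ^ n         ≈⟨ ⊛-congʳ (triangular n) ⟩
      c ^ (n C 2) ⊛ c ^ n                        ≈⟨ ⊛-comm _ _ ⟩
      c ^ n ⊛ c ^ (n C 2)                        ≈⟨ ^-homo-+ c n (n C 2) ⟨
      -- Writing n as n C 1 turns the exponent into an instance of Pascal's rule.
      c ^ (n + n C 2)                            ≡⟨ cong (λ k → c ^ (k + n C 2)) (nC1≡n n) ⟨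
      c ^ (n C 1 + n C 2)                        ≡⟨ cong (c ^_) (nCk+nC[k+1]≡[n+1]C[k+1] n 1) ⟩
      c ^ (suc n C 2)                            ∎

  RHS₁≈RHS₂ : ∀ n l → 1 ≤ n → RHS₁ R n (const 1#) l ≈ RHS₂ R n l
  RHS₁≈RHS₂ (suc m) l _ = RΣ.⨁-cong (Ybrgy (suc m)) (λ {α} α∈ → ⊛-congˡ (begin
    RΠ.⨁ (range 1 m) (λ i → 1# ^ ((suc m ∸ i) ∸ Ei (suc m) α i)) ⊛
      RΣ.⨁ (rowShuffles (suc m) α) (λ α′ → RΠ.⨁ (range 2 (suc m)) (λ d → 1# ^ Ed (suc m) α′ d))
      ≈⟨ ⊛-cong (ones (λ i → (suc m ∸ i) ∸ Ei (suc m) α i) (range 1 m))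
           (RΣ.⨁-cong (rowShuffles (suc m) α) (λ {α′} _ → ones (Ed (suc m) α′) (range 2 (suc m)))) ⟩
    1# ⊛ RΣ.⨁ (rowShuffles (suc m) α) (λ _ → 1#)
      ≈⟨ ⊛-identityˡ _ ⟩
    RΣ.⨁ (rowShuffles (suc m) α) (λ _ → 1#)
      ≈⟨ RΣ.⨁-const 1# (rowShuffles (suc m) α) ⟩
    length (rowShuffles (suc m) α) · 1#
      ≡⟨ cong (_· 1#) (length-rowShuffles m (proj₁ (∈-Ybrgy⁻ α∈))) ⟩
    ℕΠ.⨁ (range 1 m) (λ i → ℕΠ.⨁ (range i m) (λ k → Cik α (suc i) k C Eik (suc m) α i k)) · 1#
      ≈⟨ ·1-Π (λ i → ℕΠ.⨁ (range i m) (λ k → Cik α (suc i) k C Eik (suc m) α i k)) (range 1 m) ⟩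
    RΠ.⨁ (range 1 m) (λ i → ℕΠ.⨁ (range i m) (λ k → Cik α (suc i) k C Eik (suc m) α i k) · 1#)
      ≈⟨ RΠ.⨁-cong (range 1 m) (λ {i} _ → ·1-Π (λ k → Cik α (suc i) k C Eik (suc m) α i k) (range i m)) ⟩
    RΠ.⨁ (range 1 m) (λ i → RΠ.⨁ (range i m) (λ k → (Cik α (suc i) k C Eik (suc m) α i k) · 1#)) ∎))
    where
    ones : ∀ {A : Set} (e : A → ℕ) (xs : List A) → RΠ.⨁ xs (λ x → 1# ^ e x) ≈ 1#
    ones e xs = ≈-trans (RΠ.⨁-cong xs (λ {x} _ → 1^n≈1 (e x))) (RΠ.⨁-ε xs)

  identity₂ : ∀ n l → 1 ≤ n → LHS₂ R n l ≈ RHS₂ R n l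
  identity₂ n l 1≤n = ≈-trans (LHS₂≈LHS₁ n l)
    (≈-trans (identity₁ (const 1#) l n 1≤n) (RHS₁≈RHS₂ n l 1≤n))

theorem19 : (n : ℕ) → 1 ≤ n → (R : CommutativeSemiring 0ℓ 0ℓ) →
    ((x : ℕ → CommutativeSemiring.Carrier R) → (l : CommutativeSemiring.Carrier R) →
    CommutativeSemiring._≈_ R (LHS₁ R n x l) (RHS₁ R n x l))
    × ((l : CommutativeSemiring.Carrier R) →
    CommutativeSemiring._≈_ R (LHS₂ R n l) (RHS₂ R n l))
theorem19 n 1≤n R = (λ x l → identity₁ R x l n 1≤n) , (λ l → identity₂ R n l 1≤n)
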